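{- Every data structure in the Word RAM model that maintains an unweighted rooted forest with $n$ vertices under the operations \textsf{subtree-sum} and \textsf{cut} requires $\Omega\!\left(n\frac{\log n}{\log\log n}\right)$ time for $n$ operations.
   Context: Operations: $\textsf{cut}(v)$ deletes the edge between $v$ and its parent (legal only if $v$ is not a root); $\textsf{subtree-sum}(v)$ returns the number of vertices in the subtree of the current forest rooted at $v$. The Word RAM has words of $\Theta(\log n)$ bits. -}

module Defs where

open import Data.Bool.Base using (Bool; _∧_; _∨_; _xor_; if_then_else_)
open import Data.Fin.Base using (Fin; toℕ; finToFun; funToFin; _↑ˡ_; _↑ʳ_)
open import Data.Fin.Properties using (2↔Bool; _≟_)
open import Data.List.Base using (List; head; drop)
open import Data.Maybe.Base using (Maybe; just; nothing)
open import Data.Maybe.Properties using (just-injective)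
open import Data.Nat.Base
  using (ℕ; zero; suc; _+_; _*_; _∸_; _^_; _≤_; _≥_; _≡ᵇ_; _<ᵇ_)
open import Data.Nat.DivMod using (_/_; _%_; _mod_)
open import Data.Nat.Properties using (m^n≢0)
open import Data.Product.Base using (∃-syntax; _×_; _,_)
open import Data.Vec.Base using (count; allFin)
open import Data.Vec.Functional using (Vector; updateAt; _++_)
open import Data.Vec.Functional.Properties using (updateAt-updates; updateAt-minimal)
open import Function.Base using (const; case_of_)
open import Function.Bundles using (Inverse)
open import Induction.WellFounded using (WellFounded; Acc; acc; module Subrelation)
open import Relation.Binary.Construct.Closure.ReflexiveTransitive using (Star; ε; _◅_)
open import Relation.Binary.PropositionalEquality
  using (_≡_; refl; sym; trans; subst)
open import Relation.Nullary using (¬_; Dec; yes; no)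

------------------------------------------------------------------------
-- Asymptotics

_=Θ_ : (ℕ → ℕ) → (ℕ → ℕ) → Set
f =Θ g = ∃[ c ] ∃[ n₀ ] (∀ n → n ≥ n₀ → f n ≤ c * g n × g n ≤ c * f n)

------------------------------------------------------------------------
-- Rooted forests on n labelled vertices

record Forest (n : ℕ) : Set where
  field
    parent  : Vector (Maybe (Fin n)) n
    acyclic : WellFounded (λ p u → parent u ≡ just p)

  ChildOf : Fin n → Fin n → Set
  ChildOf u p = parent u ≡ just p

  IsRoot : Fin n → Set
  IsRoot v = parent v ≡ nothing

  -- Every vertex is a descendant of itself.
  DescendantOf : Fin n → Fin n → Set
  DescendantOf = Star ChildOf

  descendantOf? : ∀ v u → Dec (DescendantOf u v)
  descendantOf? v u = go u (acyclic u)
    where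
    go : ∀ u → Acc (λ p u → parent u ≡ just p) u → Dec (DescendantOf u v)
    go u (acc rs) with u ≟ v | parent u in eq
    ... | yes refl | _       = yes ε
    ... | no u≢v   | nothing = no λ
      { ε       → u≢v refl
      ; (e ◅ _) → case trans (sym eq) e of λ ()
      }
    ... | no u≢v   | just p  with go p (rs refl)
    ...   | yes p↝v = yes (eq ◅ p↝v)
    ...   | no ¬p↝v = no λ
      { ε         → u≢v refl
      ; (e ◅ q↝v) → ¬p↝v (subst (λ q → DescendantOf q v)
                            (just-injective (trans (sym e) eq)) q↝v)
      }

  subtreeSize : Fin n → ℕ
  subtreeSize v = count (descendantOf? v) (allFin n)

open Forest

cutEdge : ∀ {n} → Forest n → Fin n → Forest n
cutEdge {n} F v = record
  { parent  = parent′
  ; acyclic = Subrelation.wellFounded (λ {p} {u} → old p u) (acyclic F)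
  }
  where
  parent′ : Vector (Maybe (Fin n)) n
  parent′ = updateAt (parent F) v (const nothing)

  old : ∀ p u → parent′ u ≡ just p → parent F u ≡ just p
  old p u e with u ≟ v
  ... | no u≢v   = trans (sym (updateAt-minimal u v (parent F) u≢v)) e
  ... | yes refl with trans (sym (updateAt-updates u (parent F))) e
  ...   | ()

-- Legal sequences of m operations, starting from a given forest.
data Operations {n : ℕ} (F : Forest n) : ℕ → Set where
  []          : Operations F 0
  cut         : ∀ {m} (v : Fin n) → ¬ IsRoot F v →
                Operations (cutEdge F v) m → Operations F (suc m)
  subtree-sum : ∀ {m} (v : Fin n) → Operations F m → Operations F (suc m)

------------------------------------------------------------------------
-- Words

Word : ℕ → Set
Word w = Fin (2 ^ w)

word : ∀ w → ℕ → Word w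
word w x = _mod_ x (2 ^ w) {{m^n≢0 2 w}}

bitwise : ∀ w → (Bool → Bool → Bool) → Word w → Word w → Word w
bitwise w f x y = funToFin {w} λ i → from (f (to (finToFun x i)) (to (finToFun y i)))
  where open Inverse 2↔Bool using (to; from)

-- Numbers are exchanged with the outside in k words, most significant first.
digits : ∀ w k → ℕ → Vector (Word w) k
digits w k x = finToFun (_mod_ x ((2 ^ w) ^ k) {{m^n≢0 (2 ^ w) k {{m^n≢0 2 w}}}})

fromDigits : ∀ w k → Vector (Word w) k → ℕ
fromDigits w k ds = toℕ (funToFin ds)

------------------------------------------------------------------------
-- The Word RAM

data BinaryOp : Set where
  add sub mul div rem and or xor shl shr eq lt : BinaryOp

-- Arithmetic is modulo 2 ^ w; division and remainder by zero yield zero.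
⟦_⟧ : BinaryOp → ∀ w → Word w → Word w → Word w
⟦ and ⟧ w x y = bitwise w _∧_ x y
⟦ or  ⟧ w x y = bitwise w _∨_ x y
⟦ xor ⟧ w x y = bitwise w _xor_ x y
⟦ add ⟧ w x y = word w (toℕ x + toℕ y)
⟦ sub ⟧ w x y = word w (toℕ x + (2 ^ w ∸ toℕ y))
⟦ mul ⟧ w x y = word w (toℕ x * toℕ y)
⟦ div ⟧ w x y with toℕ y
... | zero      = word w 0
... | d@(suc _) = word w (toℕ x / d)
⟦ rem ⟧ w x y with toℕ y
... | zero      = word w 0
... | d@(suc _) = word w (toℕ x % d)
⟦ shl ⟧ w x y = word w (toℕ x * 2 ^ toℕ y)
⟦ shr ⟧ w x y = word w (_/_ (toℕ x) (2 ^ toℕ y) {{m^n≢0 2 (toℕ y)}})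
⟦ eq  ⟧ w x y = word w (if toℕ x ≡ᵇ toℕ y then 1 else 0)
⟦ lt  ⟧ w x y = word w (if toℕ x <ᵇ toℕ y then 1 else 0)

-- r is the number of registers.
data Instruction (r : ℕ) : Set where
  set    : (d : Fin r) (c : ℕ) → Instruction r
  op     : BinaryOp → (d a b : Fin r) → Instruction r
  load   : (d addr : Fin r) → Instruction r
  store  : (addr a : Fin r) → Instruction r
  ifZero : (a : Fin r) (target : ℕ) → Instruction r

Program : ℕ → Set
Program r = List (Instruction r)

record State (w r : ℕ) : Set where
  constructor ⟨_,_⟩
  field
    registers : Vector (Word w) r
    memory    : Vector (Word w) (2 ^ w)

open State

step : ∀ {w r} → Instruction r → ℕ × State w r → ℕ × State w r
step {w} (set d c)    (pc , ⟨ R , M ⟩) = suc pc , ⟨ updateAt R d (const (word w c)) , M ⟩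
step {w} (op f d a b) (pc , ⟨ R , M ⟩) = suc pc , ⟨ updateAt R d (const (⟦ f ⟧ w (R a) (R b))) , M ⟩
step (load d addr)    (pc , ⟨ R , M ⟩) = suc pc , ⟨ updateAt R d (const (M (R addr))) , M ⟩
step (store addr a)   (pc , ⟨ R , M ⟩) = suc pc , ⟨ R , updateAt M (R addr) (const (R a)) ⟩
step (ifZero a l)     (pc , ⟨ R , M ⟩) = (if toℕ (R a) ≡ᵇ 0 then l else suc pc) , ⟨ R , M ⟩

fetch : ∀ {r} → Program r → ℕ → Maybe (Instruction r)
fetch P pc = head (drop pc P)

-- Exec P c t s: started in configuration c, P halts after exactly t
-- instructions in state s.  Leaving the program text is halting.
data Exec {w r} (P : Program r) : ℕ × State w r → ℕ → State w r → Set where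
  halt : ∀ {pc s} → fetch P pc ≡ nothing → Exec P (pc , s) 0 s
  next : ∀ {pc s i t s′} → fetch P pc ≡ just i →
         Exec P (step i (pc , s)) t s′ → Exec P (pc , s) (suc t) s′

------------------------------------------------------------------------
-- Data structures

-- The programs do not depend on n; w n is the word size for n-vertex forests.
-- A vertex, and likewise an answer, occupies the first k registers.  The
-- state set up for the initial forest is unrestricted, and all registers
-- and memory persist between operations.
record DataStructure (w : ℕ → ℕ) : Set where
  field
    k r         : ℕ
    cutProgram  : Program (k + r)
    sumProgram  : Program (k + r)
    initial     : ∀ {n} → Forest n → State (w n) (k + r)

module _ {w : ℕ → ℕ} (D : DataStructure w) where
  open DataStructure D

  withArgument : ∀ {n} → Fin n → State (w n) (k + r) → State (w n) (k + r)
  withArgument {n} v ⟨ R , M ⟩ =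
    ⟨ digits (w n) k (toℕ v) ++ (λ i → R (k ↑ʳ i)) , M ⟩

  answer : ∀ {n} → State (w n) (k + r) → ℕ
  answer {n} s = fromDigits (w n) k λ i → registers s (i ↑ˡ r)

  -- From state s, the given operations on F are all performed and answered
  -- correctly, in t instructions altogether.
  data Serves {n : ℕ} : ∀ {F : Forest n} {m} → State (w n) (k + r) →
                        Operations F m → ℕ → Set where
    []          : ∀ {F s} → Serves {F = F} s [] 0
    cut         : ∀ {F m s s′ v nonRoot t t′} {ops : Operations (cutEdge F v) m} →
                  Exec cutProgram (0 , withArgument v s) t s′ →
                  Serves s′ ops t′ →
                  Serves {F = F} s (cut v nonRoot ops) (t + t′)
    subtree-sum : ∀ {F m s s′ v t t′} {ops : Operations F m} →
                  Exec sumProgram (0 , withArgument v s) t s′ →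
                  answer {n} s′ ≡ subtreeSize F v →
                  Serves s′ ops t′ →
                  Serves s (subtree-sum v ops) (t + t′)

  -- Correctness is only asked for from some size on, as w is only
  -- constrained asymptotically.
  MaintainsForests : Set
  MaintainsForests =
    ∃[ n₁ ] (∀ n → n ≥ n₁ → (F : Forest n) → ∀ {m} (ops : Operations F m) →
             ∃[ t ] Serves (initial F) ops t)

{-# OPTIONS --safe #-}
-- The chronogram method, with all averages written as sums over finite lists.
-- In a caterpillar, cutting pendant leaves and asking for the subtree sizes of
-- spine vertices is a partial sums problem: an update deletes the weight of a
-- position or not, according to a bit, and a query returns the weight from a
-- position on.  Each round is an update, at positions in bit-reversed order,
-- and a query; bits and queries vary over all their values.
--
-- Rounds are grouped into blocks of 2^(jg) rounds.  Fix a round in the right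
-- half of a block of level j + 1, and consider its sub-block of level j.  All
-- bits of the left half are variable, and the queries separate their positions.
-- If few queries touched a cell whose last probe lies in the block but not in
-- the sub-block, then the registers and the cells probed in the sub-block,
-- fewer words than there are bits, would determine most answers and hence
-- almost all bits.  So a query probes such a cell with constant probability,
-- and since the cells for different j are distinct, a round costs Ω(log n / g)
-- on average, where g = O(log log n).

module Submission where

open import Defs
open import Data.Bool.Base using (Bool; true; false; T; _∧_; if_then_else_)
open import Data.Bool.Properties using (∧-zeroʳ)
open import Data.Empty using (⊥)
open import Data.Fin.Base as Fin using (Fin; toℕ; funToFin; combine; splitAt; _↑ʳ_; _↑ˡ_)
open import Data.Fin.Properties using (_≟_; toℕ-fromℕ<)
open import Data.List.Base
  using (List; []; _∷_; [_]; _++_; map; length; replicate; upTo;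
         cartesianProduct; cartesianProductWith; allFin)
open import Data.List.Membership.Propositional using (_∈_; _∉_)
open import Data.List.Membership.Propositional.Properties
  using (∈-cartesianProductWith⁺; ∈-map⁺; ∈-++⁺ˡ; ∈-++⁺ʳ; ∈-upTo⁺; ∈-upTo⁻; ∈-allFin)
open import Data.List.Properties
  using (map-upTo; length-upTo; length-tabulate; length-replicate; ++-assoc; length-++)
import Data.List.Membership.DecPropositional as DecMembership
open import Data.List.Relation.Unary.Any using (here; there)
open import Data.Maybe.Base as Maybe using (Maybe; just; nothing)
open import Data.Nat
  using (ℕ; zero; suc; _+_; _*_; _∸_; _^_; _≤_; _<_; _≥_;
         _≤?_; _<?_; _≤ᵇ_; _≡ᵇ_; z≤n; s≤s; z<s; NonZero; >-nonZero; ⌊_/2⌋; ⌈_/2⌉)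
open import Data.Nat.DivMod
  using (_mod_; _%_; _/_; m%n<n; m%n≤m; m<n⇒m%n≡m; m/n≤m; m≥n⇒m/n>0; m≡m%n+[m/n]*n)
open import Data.Nat.Induction using (<-rec; <-wellFounded)
open import Data.Nat.Logarithm
  using (⌊log₂_⌋; ⌊log₂⌋-mono-≤; ⌊log₂[2^n]⌋≡n; ⌊log₂⌊n/2⌋⌋≡⌊log₂n⌋∸1)
open import Data.Nat.Properties hiding (_≟_)
open import Data.Nat.Tactic.RingSolver using (solve-∀)
open import Data.Product using (∃-syntax; Σ-syntax; _×_; _,_; proj₁; proj₂)
open import Data.Sum.Base using (inj₁; inj₂)
open import Data.Unit.Base using (⊤)
open import Data.Vec.Base using (Vec; []; _∷_; count; tabulate; lookup)
open import Data.Vec.Properties using (lookup∘tabulate)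
open import Data.Vec.Functional using (Vector; updateAt)
open import Data.Vec.Functional.Properties using (updateAt-minimal; updateAt-updates)
open import Function.Base using (_∘_; const; id)
open import Function.Bundles using (mk⇔)
open import Induction.WellFounded using (module Subrelation)
open import Relation.Binary.Construct.Closure.ReflexiveTransitive using (ε; _◅_)
import Relation.Binary.Construct.On as On
open import Relation.Binary.PropositionalEquality hiding ([_])
open import Relation.Nullary using (¬_; Dec; yes; no; does; contradiction)
open import Relation.Nullary.Decidable using (does-⇔; dec-false)

-- The probes of the sub-block itself may pass on what the left half did, so they must be too few to
-- carry its bits. With at most `M` probes per round, each an address and a content of `w` bits, and
-- both `M` and `w` of order log n, a sub-block learns O(log² n) bits per round. The left half must
-- be longer by such a factor, so g is about 2 log log n. Exceeding the budget `M` is no escape: it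
-- already costs at least as much per round as the number j ≤ `M` of levels.
--
-- In place of an encoding there is a union bound over all summaries of what a sub-block has probed,
-- with an exponential moment of the number of correctly guessed answers.
--
-- That the levels count distinct probes is never stated. Each level yields an inequality: its gain,
-- plus the hits within the sub-block's own history, is at most the hits within the history of the
-- block, plus a penalty. The inner hits cancel when levels are added. Only right halves profit from
-- a level, so they must gain two units for the block to gain one on average.

private
  variable
    X Y Z : Set
    a m n : ℕ

^-distribʳ-* : ∀ k m n → (m * n) ^ k ≡ m ^ k * n ^ k
^-distribʳ-* zero    m n = refl
^-distribʳ-* (suc k) m n rewrite ^-distribʳ-* k m n = interchange m n (m ^ k) (n ^ k)
  where
  interchange : ∀ m n i j → m * n * (i * j) ≡ m * i * (n * j)
  interchange = solve-∀

-- Finite sums in the role of averages.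

∑ : List X → (X → ℕ) → ℕ
∑ []       f = 0
∑ (x ∷ xs) f = f x + ∑ xs f

infix 5 ∑
syntax ∑ xs (λ x → e) = ∑[ x ← xs ] e

∑-mono-∈ : ∀ (xs : List X) {f g} → (∀ {x} → x ∈ xs → f x ≤ g x) → ∑ xs f ≤ ∑ xs g
∑-mono-∈ []       f≤g = z≤n
∑-mono-∈ (x ∷ xs) f≤g = +-mono-≤ (f≤g (here refl)) (∑-mono-∈ xs (f≤g ∘ there))

∑-mono : ∀ (xs : List X) {f g} → (∀ x → f x ≤ g x) → ∑ xs f ≤ ∑ xs g
∑-mono xs f≤g = ∑-mono-∈ xs λ {x} _ → f≤g x

∑-cong : ∀ (xs : List X) {f g} → (∀ x → f x ≡ g x) → ∑ xs f ≡ ∑ xs g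
∑-cong []       f≡g = refl
∑-cong (x ∷ xs) f≡g = cong₂ _+_ (f≡g x) (∑-cong xs f≡g)

∑-+ : ∀ (xs : List X) f g → ∑[ x ← xs ] (f x + g x) ≡ ∑ xs f + ∑ xs g
∑-+ []       f g = refl
∑-+ (x ∷ xs) f g rewrite ∑-+ xs f g = interchange (f x) (g x) (∑ xs f) (∑ xs g)
  where
  interchange : ∀ i j k l → i + j + (k + l) ≡ i + k + (j + l)
  interchange = solve-∀

∑-* : ∀ (xs : List X) k f → ∑[ x ← xs ] k * f x ≡ k * ∑ xs f
∑-* []       k f = sym (*-zeroʳ k)
∑-* (x ∷ xs) k f rewrite ∑-* xs k f = sym (*-distribˡ-+ k (f x) (∑ xs f))

∑-const : ∀ (xs : List X) k → ∑[ _ ← xs ] k ≡ length xs * k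
∑-const []       k = refl
∑-const (x ∷ xs) k = cong (k +_) (∑-const xs k)

∑-zero : ∀ (xs : List X) → ∑[ _ ← xs ] 0 ≡ 0
∑-zero xs = trans (∑-const xs 0) (*-zeroʳ (length xs))

∑-swap : ∀ (xs : List X) (ys : List Y) (f : X → Y → ℕ) →
         ∑[ x ← xs ] (∑[ y ← ys ] f x y) ≡ ∑[ y ← ys ] (∑[ x ← xs ] f x y)
∑-swap []       ys f = sym (∑-zero ys)
∑-swap (x ∷ xs) ys f rewrite ∑-swap xs ys f =
  sym (∑-+ ys (f x) (λ y → ∑[ x ← xs ] f x y))

∑-++ : ∀ (xs ys : List X) f → ∑ (xs ++ ys) f ≡ ∑ xs f + ∑ ys f
∑-++ []       ys f = refl
∑-++ (x ∷ xs) ys f rewrite ∑-++ xs ys f = sym (+-assoc (f x) _ _)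

∑-map : ∀ (xs : List X) (g : X → Y) f → ∑ (map g xs) f ≡ ∑ xs (f ∘ g)
∑-map []       g f = refl
∑-map (x ∷ xs) g f = cong (f (g x) +_) (∑-map xs g f)

∑-product : ∀ (g : X → Y → Z) xs ys f →
            ∑ (cartesianProductWith g xs ys) f ≡ ∑[ x ← xs ] (∑[ y ← ys ] f (g x y))
∑-product g []       ys f = refl
∑-product g (x ∷ xs) ys f =
  trans (∑-++ (map (g x) ys) _ f)
        (cong₂ _+_ (∑-map ys (g x) f) (∑-product g xs ys f))

∑-∈ : ∀ {xs : List X} {x} f → x ∈ xs → f x ≤ ∑ xs f
∑-∈ f (here refl) = m≤m+n _ _
∑-∈ f (there {x = x} x∈xs) = ≤-trans (∑-∈ f x∈xs) (m≤n+m _ (f x))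

-- Applied in `expensive`, to extract one costly sequence of rounds from the sum over all of them.
∑-average : ∀ (xs : List X) f k → 0 < length xs → length xs * k ≤ ∑ xs f → ∃[ x ] k ≤ f x
∑-average (x ∷ xs) f k _ le with k ≤? f x
... | yes k≤fx = x , k≤fx
∑-average (x ∷ [])     f k _ le | no k≰fx =
  contradiction (subst₂ _≤_ (+-identityʳ k) (+-identityʳ (f x)) le) k≰fx
∑-average (x ∷ y ∷ xs) f k _ le | no k≰fx = ∑-average (y ∷ xs) f k z<s
  (+-cancelˡ-≤ k _ _ (≤-trans le (+-monoˡ-≤ (∑ (y ∷ xs) f) (<⇒≤ (≰⇒> k≰fx)))))

length-∑ : ∀ (xs : List X) → length xs ≡ ∑[ _ ← xs ] 1
length-∑ xs = sym (trans (∑-const xs 1) (*-identityʳ (length xs)))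

length-product : ∀ (g : X → Y → Z) xs ys →
                 length (cartesianProductWith g xs ys) ≡ length xs * length ys
length-product g xs ys = begin
  length (cartesianProductWith g xs ys)  ≡⟨ length-∑ (cartesianProductWith g xs ys) ⟩
  ∑ (cartesianProductWith g xs ys) (const 1) ≡⟨ ∑-product g xs ys _ ⟩
  ∑[ _ ← xs ] (∑[ _ ← ys ] 1)            ≡⟨ ∑-const xs _ ⟩
  length xs * (∑[ _ ← ys ] 1)            ≡⟨ cong (length xs *_) (length-∑ ys) ⟨
  length xs * length ys                  ∎
  where open ≡-Reasoning

∑∑-+ : ∀ (xs : List X) (ys : List Y) (f₁ : X → ℕ) (f₂ : X → Y → ℕ) →
       ∑[ x ← xs ] (∑[ y ← ys ] (f₁ x + f₂ x y)) ≡
       length ys * ∑ xs f₁ + (∑[ x ← xs ] ∑ ys (f₂ x))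
∑∑-+ xs ys f₁ f₂ =
  trans (∑-cong xs λ x → trans (∑-+ ys (const (f₁ x)) (f₂ x))
                               (cong (_+ ∑ ys (f₂ x)) (∑-const ys (f₁ x))))
  (trans (∑-+ xs _ _)
         (cong (_+ (∑[ x ← xs ] ∑ ys (f₂ x))) (∑-* xs (length ys) f₁)))

-- The recursion pattern for a block with halves `x` and `y`: the earlier half does not see the
-- later one, so an inequality averaged over `x` alone can be added to one averaged over both.
∑∑-+-mono : ∀ (xs : List X) (ys : List Y) (f₁ g₁ : X → ℕ) (f₂ g₂ : X → Y → ℕ) →
            ∑ xs f₁ ≤ ∑ xs g₁ → ∑[ x ← xs ] ∑ ys (f₂ x) ≤ ∑[ x ← xs ] ∑ ys (g₂ x) →
            ∑[ x ← xs ] (∑[ y ← ys ] (f₁ x + f₂ x y)) ≤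
            ∑[ x ← xs ] (∑[ y ← ys ] (g₁ x + g₂ x y))
∑∑-+-mono xs ys f₁ g₁ f₂ g₂ le₁ le₂ = begin
  ∑[ x ← xs ] (∑[ y ← ys ] (f₁ x + f₂ x y))         ≡⟨ ∑∑-+ xs ys f₁ f₂ ⟩
  length ys * ∑ xs f₁ + (∑[ x ← xs ] ∑ ys (f₂ x))   ≤⟨ +-mono-≤ (*-monoʳ-≤ (length ys) le₁) le₂ ⟩
  length ys * ∑ xs g₁ + (∑[ x ← xs ] ∑ ys (g₂ x))   ≡⟨ ∑∑-+ xs ys g₁ g₂ ⟨
  ∑[ x ← xs ] (∑[ y ← ys ] (g₁ x + g₂ x y))         ∎
  where open ≤-Reasoning

∑-const-upTo : ∀ n k → ∑[ _ ← upTo n ] k ≡ n * k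
∑-const-upTo n k = trans (∑-const (upTo n) k) (cong (_* k) (length-upTo n))

∑-upTo-suc : ∀ n f → ∑ (upTo (suc n)) f ≡ f 0 + ∑ (upTo n) (f ∘ suc)
∑-upTo-suc n f =
  cong (f 0 +_) (trans (cong (λ xs → ∑ xs f) (sym (map-upTo suc n))) (∑-map (upTo n) suc f))

∑-upTo-+ : ∀ m n f → ∑ (upTo (m + n)) f ≡ ∑ (upTo m) f + (∑[ i ← upTo n ] f (m + i))
∑-upTo-+ zero    n f = refl
∑-upTo-+ (suc m) n f
  rewrite ∑-upTo-suc (m + n) f | ∑-upTo-suc m f | ∑-upTo-+ m n (f ∘ suc) =
  sym (+-assoc (f 0) _ _)

∑-upTo-* : ∀ m n f → ∑ (upTo (m * n)) f ≡ ∑[ i ← upTo m ] (∑[ j ← upTo n ] f (i * n + j))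
∑-upTo-* zero    n f = refl
∑-upTo-* (suc m) n f
  rewrite ∑-upTo-+ n (m * n) f
        | ∑-upTo-suc m (λ i → ∑[ j ← upTo n ] f (i * n + j))
        | ∑-upTo-* m n (λ i → f (n + i)) =
  cong (∑ (upTo n) f +_)
    (∑-cong (upTo m) λ i → ∑-cong (upTo n) λ j → cong f (sym (+-assoc n (i * n) j)))

-- Bit vectors, trees of rounds and the bit-reversed order.

vecs : List X → ∀ n → List (Vec X n)
vecs xs zero    = [ [] ]
vecs xs (suc n) = cartesianProductWith _∷_ xs (vecs xs n)

length-vecs : ∀ (xs : List X) n → length (vecs xs n) ≡ length xs ^ n
length-vecs xs zero    = refl
length-vecs xs (suc n) =
  trans (length-product _∷_ xs (vecs xs n)) (cong (length xs *_) (length-vecs xs n))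

∈-vecs : ∀ {xs : List X} → (∀ x → x ∈ xs) → (v : Vec X n) → v ∈ vecs xs n
∈-vecs all []      = here refl
∈-vecs all (x ∷ v) = ∈-cartesianProductWith⁺ _∷_ (all x) (∈-vecs all v)

double : ℕ → ℕ
double zero    = zero
double (suc n) = suc (suc (double n))

double≡2* : ∀ n → double n ≡ 2 * n
double≡2* zero    = refl
double≡2* (suc n) rewrite double≡2* n = cong suc (sym (+-suc n (n + 0)))

interleave : Vec X n → Vec X n → Vec X (double n)
interleave []      []      = []
interleave (x ∷ u) (y ∷ v) = x ∷ y ∷ interleave u v

∑-interleave : ∀ (xs : List X) n f →
               ∑ (vecs xs (double n)) f ≡
               ∑[ u ← vecs xs n ] (∑[ v ← vecs xs n ] f (interleave u v))
∑-interleave xs zero    f = sym (+-identityʳ _)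
∑-interleave xs (suc n) f = begin
  ∑ (vecs xs (double (suc n))) f
    ≡⟨ trans (∑-product _∷_ xs _ f) (∑-cong xs λ x → ∑-product _∷_ xs _ _) ⟩
  ∑[ x ← xs ] (∑[ y ← xs ] (∑[ w ← vecs xs (double n) ] f (x ∷ y ∷ w)))
    ≡⟨ (∑-cong xs λ x → ∑-cong xs λ y → ∑-interleave xs n _) ⟩
  ∑[ x ← xs ] (∑[ y ← xs ] (∑[ u ← us ] (∑[ v ← us ] f (x ∷ y ∷ interleave u v))))
    ≡⟨ (∑-cong xs λ x → ∑-swap xs us _) ⟩
  ∑[ x ← xs ] (∑[ u ← us ] (∑[ y ← xs ] (∑[ v ← us ] f (x ∷ y ∷ interleave u v))))
    ≡⟨ (∑-cong xs λ x → ∑-cong us λ u → ∑-product _∷_ xs us _) ⟨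
  ∑[ x ← xs ] (∑[ u ← us ] (∑[ v ← vecs xs (suc n) ] f (interleave (x ∷ u) v)))
    ≡⟨ ∑-product _∷_ xs us _ ⟨
  ∑[ u ← vecs xs (suc n) ] (∑[ v ← vecs xs (suc n) ] f (interleave u v)) ∎
  where
  open ≡-Reasoning
  us = vecs xs n

data Tree (X : Set) : ℕ → Set where
  leaf : X → Tree X 0
  node : Tree X a → Tree X a → Tree X (suc a)

trees : List X → ∀ a → List (Tree X a)
trees xs zero    = map leaf xs
trees xs (suc a) = cartesianProductWith node (trees xs a) (trees xs a)

zipTree : Tree X a → Tree Y a → Tree (X × Y) a
zipTree (leaf x)   (leaf y)     = leaf (x , y)
zipTree (node l r) (node l′ r′) = node (zipTree l l′) (zipTree r r′)

-- Pulls the queries `ys` of a block out of the sum, so that they can be frozen while the bits `xs`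
-- vary.
∑-zipTree : ∀ (xs : List X) (ys : List Y) a f →
            ∑ (trees (cartesianProduct xs ys) a) f ≡
            ∑[ t ← trees ys a ] (∑[ s ← trees xs a ] f (zipTree s t))
∑-zipTree xs ys zero f = begin
  ∑ (map leaf (cartesianProduct xs ys)) f
    ≡⟨ trans (∑-map (cartesianProduct xs ys) leaf f) (∑-product _,_ xs ys _) ⟩
  ∑[ x ← xs ] (∑[ y ← ys ] f (leaf (x , y)))
    ≡⟨ ∑-swap xs ys _ ⟩
  ∑[ y ← ys ] (∑[ x ← xs ] f (leaf (x , y)))
    ≡⟨ trans (∑-map ys leaf _) (∑-cong ys λ y → ∑-map xs leaf _) ⟨
  ∑[ t ← trees ys 0 ] (∑[ s ← trees xs 0 ] f (zipTree s t)) ∎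
  where open ≡-Reasoning
∑-zipTree xs ys (suc a) f = begin
  ∑ (trees (cartesianProduct xs ys) (suc a)) f
    ≡⟨ trans (∑-product node ωs ωs f) (∑-zipTree xs ys a _) ⟩
  ∑[ t ← ts ] (∑[ s ← ss ] (∑[ ω ← ωs ] f (node (zipTree s t) ω)))
    ≡⟨ (∑-cong ts λ t → ∑-cong ss λ s → ∑-zipTree xs ys a _) ⟩
  ∑[ t ← ts ] (∑[ s ← ss ] (∑[ t′ ← ts ] (∑[ s′ ← ss ] f (node (zipTree s t) (zipTree s′ t′)))))
    ≡⟨ (∑-cong ts λ t → ∑-swap ss ts _) ⟩
  ∑[ t ← ts ] (∑[ t′ ← ts ] (∑[ s ← ss ] (∑[ s′ ← ss ] f (node (zipTree s t) (zipTree s′ t′)))))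
    ≡⟨ trans (∑-product node ts ts _) (∑-cong ts λ t → ∑-cong ts λ t′ → ∑-product node ss ss _) ⟨
  ∑[ t ← trees ys (suc a) ] (∑[ s ← trees xs (suc a) ] f (zipTree s t)) ∎
  where
  open ≡-Reasoning
  ωs = trees (cartesianProduct xs ys) a
  ss = trees xs a
  ts = trees ys a

leaves : ℕ → ℕ
leaves zero    = 1
leaves (suc a) = double (leaves a)

leaves≡2^ : ∀ a → leaves a ≡ 2 ^ a
leaves≡2^ zero    = refl
leaves≡2^ (suc a) = trans (double≡2* (leaves a)) (cong (2 *_) (leaves≡2^ a))

-- The rounds of a block run from the left leaf to the right one, while the
-- positions they act on are interleaved, with the right subtree first.
positional : Tree X a → Vec X (leaves a)
positional (leaf x)   = x ∷ []
positional (node l r) = interleave (positional r) (positional l)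

-- `positional` is a bijection, so an average over rounds in order of time becomes one over bits in
-- order of position, the form that `∑-3^agree` handles.
∑-positional : ∀ (xs : List X) a f →
               ∑[ t ← trees xs a ] f (positional t) ≡ ∑ (vecs xs (leaves a)) f
∑-positional xs zero    f =
  trans (∑-map xs leaf _)
        (sym (trans (∑-product _∷_ xs [ [] ] f) (∑-cong xs λ x → +-identityʳ _)))
∑-positional xs (suc a) f = begin
  ∑[ t ← trees xs (suc a) ] f (positional t)
    ≡⟨ ∑-product node ts ts _ ⟩
  ∑[ l ← ts ] (∑[ r ← ts ] f (interleave (positional r) (positional l)))
    ≡⟨ ∑-swap ts ts _ ⟩
  ∑[ r ← ts ] (∑[ l ← ts ] f (interleave (positional r) (positional l)))
    ≡⟨ (∑-cong ts λ r → ∑-positional xs a _) ⟩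
  ∑[ r ← ts ] (∑[ v ← vecs xs (leaves a) ] f (interleave (positional r) v))
    ≡⟨ ∑-positional xs a _ ⟩
  ∑[ u ← vecs xs (leaves a) ] (∑[ v ← vecs xs (leaves a) ] f (interleave u v))
    ≡⟨ ∑-interleave xs (leaves a) f ⟨
  ∑ (vecs xs (leaves (suc a))) f ∎
  where
  open ≡-Reasoning
  ts = trees xs a

length-trees : ∀ (xs : List X) a → length (trees xs a) ≡ length xs ^ leaves a
length-trees xs a = begin
  length (trees xs a)                ≡⟨ length-∑ (trees xs a) ⟩
  (∑[ _ ← trees xs a ] 1)            ≡⟨ ∑-positional xs a (const 1) ⟩
  (∑[ _ ← vecs xs (leaves a) ] 1)    ≡⟨ length-∑ (vecs xs (leaves a)) ⟨
  length (vecs xs (leaves a))        ≡⟨ length-vecs xs (leaves a) ⟩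
  length xs ^ leaves a               ∎
  where open ≡-Reasoning

∈-trees : ∀ {xs : List X} → (∀ x → x ∈ xs) → (t : Tree X a) → t ∈ trees xs a
∈-trees all (leaf x)   = ∈-map⁺ leaf (all x)
∈-trees all (node l r) = ∈-cartesianProductWith⁺ node (∈-trees all l) (∈-trees all r)

-- Guessing the suffix counts of a bit vector.

bools : List Bool
bools = true ∷ false ∷ []

bit : Bool → ℕ
bit b = if b then 1 else 0

countWith : (ℕ → Bool) → Vec Bool n → ℕ
countWith φ []      = 0
countWith φ (b ∷ v) = bit (b ∧ φ 0) + countWith (φ ∘ suc) v

countWith-cong : ∀ {φ ψ} → (∀ h → φ h ≡ ψ h) → (v : Vec Bool n) → countWith φ v ≡ countWith ψ v
countWith-cong φ≡ψ []      = refl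
countWith-cong φ≡ψ (b ∷ v) =
  cong₂ _+_ (cong (λ c → bit (b ∧ c)) (φ≡ψ 0)) (countWith-cong (φ≡ψ ∘ suc) v)

countWith-interleave : ∀ φ (u v : Vec Bool n) →
  countWith φ (interleave u v) ≡
  countWith (φ ∘ double) u + countWith (φ ∘ suc ∘ double) v
countWith-interleave φ []      []      = refl
countWith-interleave φ (b ∷ u) (c ∷ v) = begin
  bit (b ∧ φ 0) + (bit (c ∧ φ 1) + countWith (φ ∘ suc ∘ suc) (interleave u v))
    ≡⟨ cong (λ x → bit (b ∧ φ 0) + (bit (c ∧ φ 1) + x)) (countWith-interleave (φ ∘ suc ∘ suc) u v) ⟩
  bit (b ∧ φ 0) + (bit (c ∧ φ 1) + (countWith (φ ∘ double ∘ suc) u + countWith (φ ∘ suc ∘ double ∘ suc) v))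
    ≡⟨ rearrange (bit (b ∧ φ 0)) (bit (c ∧ φ 1)) _ _ ⟩
  bit (b ∧ φ 0) + countWith (φ ∘ double ∘ suc) u + (bit (c ∧ φ 1) + countWith (φ ∘ suc ∘ double ∘ suc) v) ∎
  where
  open ≡-Reasoning
  rearrange : ∀ i j k l → i + (j + (k + l)) ≡ i + k + (j + l)
  rearrange = solve-∀

-- A block (p , e) of n rounds acts on the positions p + h * e with h < n.
cuts : (ℕ → Bool) → ℕ → ℕ → Tree Bool a → ℕ
cuts φ p e (leaf b)   = bit (b ∧ φ p)
cuts φ p e (node l r) = cuts φ (p + e) (2 * e) l + cuts φ p (2 * e) r

-- Doubling the step splits `p + h * e` by the parity of `h`: even `h` belong to the right half, odd
-- `h` to the left, as in `interleave`.
cuts-positional : ∀ φ p e (t : Tree Bool a) →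
                  cuts φ p e t ≡ countWith (λ h → φ (p + h * e)) (positional t)
cuts-positional φ p e (leaf b) rewrite +-identityʳ p = sym (+-identityʳ _)
cuts-positional φ p e (node l r) = begin
  cuts φ (p + e) (2 * e) l + cuts φ p (2 * e) r
    ≡⟨ cong₂ _+_ (cuts-positional φ (p + e) (2 * e) l) (cuts-positional φ p (2 * e) r) ⟩
  countWith (λ h → φ (p + e + h * (2 * e))) (positional l) +
  countWith (λ h → φ (p + h * (2 * e))) (positional r)
    ≡⟨ +-comm (countWith _ (positional l)) _ ⟩
  countWith (λ h → φ (p + h * (2 * e))) (positional r) +
  countWith (λ h → φ (p + e + h * (2 * e))) (positional l)
    ≡⟨ cong₂ _+_ (countWith-cong even (positional r)) (countWith-cong odd (positional l)) ⟩
  countWith (λ h → φ (p + double h * e)) (positional r) +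
  countWith (λ h → φ (p + suc (double h) * e)) (positional l)
    ≡⟨ countWith-interleave _ (positional r) (positional l) ⟨
  countWith (λ h → φ (p + h * e)) (interleave (positional r) (positional l)) ∎
  where
  open ≡-Reasoning
  even : ∀ h → φ (p + h * (2 * e)) ≡ φ (p + double h * e)
  even h rewrite double≡2* h = cong φ (lemma p h e)
    where
    lemma : ∀ p h e → p + h * (2 * e) ≡ p + 2 * h * e
    lemma = solve-∀
  odd : ∀ h → φ (p + e + h * (2 * e)) ≡ φ (p + suc (double h) * e)
  odd h rewrite double≡2* h = cong φ (lemma p h e)
    where
    lemma : ∀ p h e → p + e + h * (2 * e) ≡ p + suc (2 * h) * e
    lemma = solve-∀

suc-≤ᵇ-suc : ∀ m n → (suc m ≤ᵇ suc n) ≡ (m ≤ᵇ n)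
suc-≤ᵇ-suc zero    n = refl
suc-≤ᵇ-suc (suc m) n = refl

-- The number of h for which the guess A h for κ h less the number of ones
-- from h on is correct.
agree : (ℕ → ℕ) → (ℕ → ℕ) → Vec Bool n → ℕ
agree A κ []          = 0
agree A κ v@(_ ∷ v′) = bit (A 0 + countWith (0 ≤ᵇ_) v ≡ᵇ κ 0) + agree (A ∘ suc) (κ ∘ suc) v′

-- Each `h < n` is paid for once: if `bad h` is zero, its guess counts in `agree`; otherwise `bad h`
-- is itself at least 1.
agree-all : ∀ A κ bad (v : Vec Bool n) →
            (∀ h → h < n → bad h ≡ 0 → A h + countWith (h ≤ᵇ_) v ≡ κ h) →
            n ≤ agree A κ v + ∑ (upTo n) bad
agree-all A κ bad []      correct = z≤n
agree-all {n = suc n} A κ bad v@(b ∷ v′) correct = begin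
  1 + n
    ≤⟨ +-mono-≤ first (agree-all (A ∘ suc) (κ ∘ suc) (bad ∘ suc) v′ λ h h<n ok →
         trans (cong (A (suc h) +_) (sym (skip h))) (correct (suc h) (s≤s h<n) ok)) ⟩
  hit + bad 0 + (agree (A ∘ suc) (κ ∘ suc) v′ + ∑ (upTo n) (bad ∘ suc))
    ≡⟨ interchange hit (bad 0) _ _ ⟩
  hit + agree (A ∘ suc) (κ ∘ suc) v′ + (bad 0 + ∑ (upTo n) (bad ∘ suc))
    ≡⟨ cong (hit + agree (A ∘ suc) (κ ∘ suc) v′ +_) (∑-upTo-suc n bad) ⟨
  hit + agree (A ∘ suc) (κ ∘ suc) v′ + ∑ (upTo (suc n)) bad ∎
  where
  open ≤-Reasoning
  hit = bit (A 0 + countWith (0 ≤ᵇ_) v ≡ᵇ κ 0)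
  interchange : ∀ i j k l → i + j + (k + l) ≡ i + k + (j + l)
  interchange = solve-∀
  skip : ∀ h → countWith (suc h ≤ᵇ_) v ≡ countWith (h ≤ᵇ_) v′
  skip h rewrite ∧-zeroʳ b = countWith-cong (suc-≤ᵇ-suc h) v′
  first : 1 ≤ hit + bad 0
  first with bad 0 in eq
  ... | suc k = m≤n⇒m≤o+n hit (s≤s z≤n)
  ... | zero with A 0 + countWith (0 ≤ᵇ_) v ≡ᵇ κ 0 | ≡⇒≡ᵇ _ _ (correct 0 z<s eq)
  ...   | true | _ = s≤s z≤n

-- Once the later bits are fixed, at most one value of the first bit makes the
-- guess A 0 correct.
∑-3^agree : ∀ n A κ → ∑[ v ← vecs bools n ] 3 ^ agree A κ v ≤ 4 ^ n
∑-3^agree zero    A κ = ≤-refl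
∑-3^agree (suc n) A κ = begin
  ∑[ v ← vecs bools (suc n) ] 3 ^ agree A κ v
    ≡⟨ trans (∑-product _∷_ bools (vecs bools n) _)
             (∑-swap bools (vecs bools n) λ b v → 3 ^ agree A κ (b ∷ v)) ⟩
  ∑[ v ← vecs bools n ] (∑[ b ← bools ] 3 ^ agree A κ (b ∷ v))
    ≤⟨ ∑-mono (vecs bools n) first ⟩
  ∑[ v ← vecs bools n ] 4 * 3 ^ agree (A ∘ suc) (κ ∘ suc) v
    ≡⟨ ∑-* (vecs bools n) 4 _ ⟩
  4 * (∑[ v ← vecs bools n ] 3 ^ agree (A ∘ suc) (κ ∘ suc) v)
    ≤⟨ *-monoʳ-≤ 4 (∑-3^agree n (A ∘ suc) (κ ∘ suc)) ⟩
  4 ^ suc n ∎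
  where
  open ≤-Reasoning
  both : ∀ i j → T (i + suc j ≡ᵇ κ 0) → T (i + j ≡ᵇ κ 0) → ⊥
  both i j p q = m≢1+m+n (i + j) {0}
    (trans (≡ᵇ⇒≡ _ _ q) (trans (sym (≡ᵇ⇒≡ _ _ p)) (trans (+-suc i j) (cong suc (sym (+-identityʳ _))))))
  weigh : ∀ x y → (T x → T y → ⊥) → ∀ k → 3 ^ (bit x + k) + (3 ^ (bit y + k) + 0) ≤ 4 * 3 ^ k
  weigh true  true  not-both k = contradiction _ (not-both _)
  weigh true  false _ k = ≤-reflexive (lemma (3 ^ k))
    where
    lemma : ∀ z → 3 * z + (z + 0) ≡ 4 * z
    lemma = solve-∀
  weigh false true  _ k = ≤-reflexive (lemma (3 ^ k))
    where
    lemma : ∀ z → z + (3 * z + 0) ≡ 4 * z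
    lemma = solve-∀
  weigh false false _ k = +-monoʳ-≤ (3 ^ k) (+-monoʳ-≤ (3 ^ k) z≤n)
  first : ∀ v → ∑[ b ← bools ] 3 ^ agree A κ (b ∷ v) ≤ 4 * 3 ^ agree (A ∘ suc) (κ ∘ suc) v
  first v = weigh (A 0 + suc (countWith (λ _ → true) v) ≡ᵇ κ 0) (A 0 + countWith (λ _ → true) v ≡ᵇ κ 0)
                  (both (A 0) (countWith (λ _ → true) v)) (agree (A ∘ suc) (κ ∘ suc) v)

-- Abstract probe machines and summaries of their memory.

data Op : Set where
  update : ℕ → Bool → Op
  query  : ℕ → Op

-- update p true deletes the unit of weight at the position p, and
-- response c q is the weight of the positions from q on, up to a constant.
record Machine (N s r : ℕ) : Set₁ where
  field
    address₀   : Fin s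
    Cfg        : Set
    registers  : Cfg → Vec (Fin s) r
    cell       : Cfg → Fin s → Fin s
    perform       : Cfg → Op → Cfg
    cost       : Cfg → Op → ℕ
    trace      : Cfg → Op → List (Fin s)
    trace≤cost : ∀ c o → length (trace c o) ≤ cost c o
    frame      : ∀ c o x → x ∉ trace c o → cell (perform c o) x ≡ cell c x

    Available        : Cfg → ℕ → Set
    available-query  : ∀ {c p} q → Available c p → Available (perform c (query q)) p
    available-update : ∀ {c p p′} b → p ≢ p′ → Available c p → Available (perform c (update p′ b)) p

    response        : Cfg → ℕ → ℕ
    response-query  : ∀ c q q′ → response (perform c (query q)) q′ ≡ response c q′
    response-update : ∀ {c p} b q → Available c p → q < N →
                    response (perform c (update p b)) q + bit (b ∧ (q ≤ᵇ p)) ≡ response c q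

    simulate         : ℕ → Vec (Fin s) r → (Fin s → Fin s) → ℕ → ℕ
    simulate-correct : ∀ {c q fuel mem} → cost c (query q) ≤ fuel → q < N →
                       (∀ {x} → x ∈ trace c (query q) → mem x ≡ cell c x) →
                       simulate fuel (registers c) mem q ≡ response c q

patch : ∀ {s} → Vec (Fin s × Fin s) m → (Fin s → Fin s) → Fin s → Fin s
patch []            mem x = mem x
patch ((y , v) ∷ π) mem x = if does (x ≟ y) then v else patch π mem x

module _ {s} (x₀ : Fin s) where

  -- The number of entries is fixed so that the summaries form a finite list of known length.
  -- Padding records the true content of `x₀`, so it never falsifies a patch.
  contents : ∀ m → (Fin s → Fin s) → List (Fin s) → Vec (Fin s × Fin s) m
  contents zero    mem xs       = []
  contents (suc m) mem []       = (x₀ , mem x₀) ∷ contents m mem []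
  contents (suc m) mem (x ∷ xs) = (x , mem x) ∷ contents m mem xs

  patch-contents : ∀ m (old new : Fin s → Fin s) xs x → length xs ≤ m →
                   (x ∉ xs → old x ≡ new x) → patch (contents m new xs) old x ≡ new x
  patch-contents zero    old new [] x _ same = same λ ()
  patch-contents (suc m) old new [] x _ same with x ≟ x₀
  ... | yes refl = refl
  ... | no  _    = patch-contents m old new [] x z≤n same
  patch-contents (suc m) old new (y ∷ ys) x (s≤s len) same with x ≟ y
  ... | yes refl = refl
  ... | no  x≢y  = patch-contents m old new ys x len λ x∉ys →
    same λ { (here x≡y) → x≢y x≡y ; (there x∈ys) → x∉ys x∈ys }

-- Registers, and addresses with contents. Laid over the memory from before the block, this is all
-- that a query can read unless it makes a stale probe.
Summary : ℕ → ℕ → ℕ → Set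
Summary s r m = Vec (Fin s) r × Vec (Fin s × Fin s) m

summaries : ∀ s r m → List (Summary s r m)
summaries s r m =
  cartesianProduct (vecs (allFin s) r) (vecs (cartesianProduct (allFin s) (allFin s)) m)

∈-summaries : ∀ {s r m} (π : Summary s r m) → π ∈ summaries s r m
∈-summaries (ρ , μ) = ∈-cartesianProductWith⁺ _,_ (∈-vecs ∈-allFin ρ)
  (∈-vecs (λ (x , y) → ∈-cartesianProductWith⁺ _,_ (∈-allFin x) (∈-allFin y)) μ)

length-summaries : ∀ s r m → length (summaries s r m) ≡ s ^ (r + 2 * m)
length-summaries s r m = begin
  length (summaries s r m)
    ≡⟨ length-product _,_ (vecs W r) (vecs (cartesianProduct W W) m) ⟩
  length (vecs W r) * length (vecs (cartesianProduct W W) m)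
    ≡⟨ cong₂ _*_ (length-vecs W r) (length-vecs (cartesianProduct W W) m) ⟩
  length W ^ r * length (cartesianProduct W W) ^ m
    ≡⟨ cong (λ k → length W ^ r * k ^ m) (length-product _,_ W W) ⟩
  length W ^ r * (length W * length W) ^ m
    ≡⟨ cong (λ k → k ^ r * (k * k) ^ m) (length-tabulate {n = s} (λ i → i)) ⟩
  s ^ r * (s * s) ^ m
    ≡⟨ cong (λ k → s ^ r * (s * k) ^ m) (*-identityʳ s) ⟨
  s ^ r * (s ^ 2) ^ m
    ≡⟨ cong (s ^ r *_) (^-*-assoc s 2 m) ⟩
  s ^ r * s ^ (2 * m)
    ≡⟨ ^-distribˡ-+-* s r (2 * m) ⟨
  s ^ (r + 2 * m) ∎
  where
  open ≡-Reasoning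
  W = allFin s

-- Runs, probe histories and families of configurations.

module LowerBound {N s r : ℕ} (Mach : Machine N s r) where
  open Machine Mach
  open DecMembership (_≟_ {s}) using (_∈?_)

  occurs : List (Fin s) → Fin s → ℕ
  occurs S x = bit (does (x ∈? S))

  occurs-mono : ∀ S S′ x → occurs S x ≤ occurs (S ++ S′) x
  occurs-mono S S′ x with x ∈? S | x ∈? (S ++ S′)
  ... | yes x∈S | yes _  = ≤-refl
  ... | yes x∈S | no x∉  = contradiction (∈-++⁺ˡ x∈S) x∉
  ... | no  _   | _      = z≤n

  occurs≤1 : ∀ S x → occurs S x ≤ 1
  occurs≤1 S x with x ∈? S
  ... | yes _ = ≤-refl
  ... | no  _ = z≤n

  recall : List (Fin s) → List (Fin s) → ℕ
  recall S T = ∑ T (occurs S)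

  recall-mono : ∀ S S′ T → recall S T ≤ recall (S ++ S′) T
  recall-mono S S′ T = ∑-mono T (occurs-mono S S′)

  recall≤length : ∀ S T → recall S T ≤ length T
  recall≤length S T = ≤-trans (∑-mono T (occurs≤1 S)) (≤-reflexive (sym (length-∑ T)))

  -- By `occurs-mono` the subtraction never truncates. A difference is used so that counts for
  -- nested histories telescope.
  stale : List (Fin s) → List (Fin s) → List (Fin s) → ℕ
  stale R H T = ∑ T (λ x → occurs (R ++ H) x ∸ occurs R x)

  recall-++ : ∀ R H T → recall (R ++ H) T ≡ recall R T + stale R H T
  recall-++ R H T =
    trans (∑-cong T λ x → sym (m+[n∸m]≡n (occurs-mono R H x))) (∑-+ T _ _)

  stale-free : ∀ R H T → stale R H T ≡ 0 → ∀ {x} → x ∈ T → x ∈ R ++ H → x ∈ R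
  stale-free R H T none {x} x∈T x∈R++H
    with x ∈? R | x ∈? (R ++ H)
       | ∑-∈ (λ x → occurs (R ++ H) x ∸ occurs R x) x∈T
  ... | yes x∈R | _       | _  = x∈R
  ... | no  _   | yes _   | le = contradiction (subst (1 ≤_) none le) λ ()
  ... | no  _   | no x∉   | _  = contradiction x∈R++H x∉

  -- Configurations that depend on bits y not yet known, of which δ q y cuts
  -- lie at positions from q on.  The probes made since the bits were used are
  -- R y, then H y.
  record Family (Y : Set) (δ : ℕ → Y → ℕ) : Set where
    field
      C         : Y → Cfg
      R H       : Y → List (Fin s)
      original  : Fin s → Fin s
      untouched : ∀ y {x} → x ∉ R y ++ H y → original x ≡ cell (C y) x
      κ         : ℕ → ℕ
      answers   : ∀ y q → q < N → response (C y) q + δ q y ≡ κ q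

  open Family

  run : Cfg → List Op → Cfg
  run c []       = c
  run c (o ∷ os) = run (perform c o) os

  runCost : Cfg → List Op → ℕ
  runCost c []       = 0
  runCost c (o ∷ os) = cost c o + runCost (perform c o) os

  history : Cfg → List (Fin s) → List Op → List (Fin s)
  history c S []       = S
  history c S (o ∷ os) = history (perform c o) (trace c o ++ S) os

  -- `S` grows only after each operation, so probes within one operation are not compared with each
  -- other. Enlarging the initial `S` adds exactly the probes of cells last probed in the added
  -- part; this is how levels are told apart.
  hits : Cfg → List (Fin s) → List Op → ℕ
  hits c S []       = 0
  hits c S (o ∷ os) = recall S (trace c o) + hits (perform c o) (trace c o ++ S) os

  run-++ : ∀ c os os′ → run c (os ++ os′) ≡ run (run c os) os′
  run-++ c []       os′ = refl
  run-++ c (o ∷ os) os′ = run-++ (perform c o) os os′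

  runCost-++ : ∀ c os os′ → runCost c (os ++ os′) ≡ runCost c os + runCost (run c os) os′
  runCost-++ c []       os′ = refl
  runCost-++ c (o ∷ os) os′ rewrite runCost-++ (perform c o) os os′ = sym (+-assoc (cost c o) _ _)

  hits-++ : ∀ c S os os′ →
            hits c S (os ++ os′) ≡ hits c S os + hits (run c os) (history c S os) os′
  hits-++ c S []       os′ = refl
  hits-++ c S (o ∷ os) os′ rewrite hits-++ (perform c o) (trace c o ++ S) os os′ =
    sym (+-assoc (recall S (trace c o)) _ _)

  history-++ˢ : ∀ c S S′ os → history c (S ++ S′) os ≡ history c S os ++ S′
  history-++ˢ c S S′ []       = refl
  history-++ˢ c S S′ (o ∷ os)
    rewrite sym (++-assoc (trace c o) S S′) = history-++ˢ (perform c o) (trace c o ++ S) S′ os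

  hits-mono : ∀ c S S′ os → hits c S os ≤ hits c (S ++ S′) os
  hits-mono c S S′ []       = z≤n
  hits-mono c S S′ (o ∷ os) rewrite sym (++-assoc (trace c o) S S′) =
    +-mono-≤ (recall-mono S S′ (trace c o)) (hits-mono (perform c o) (trace c o ++ S) S′ os)

  hits≤runCost : ∀ c S os → hits c S os ≤ runCost c os
  hits≤runCost c S []       = z≤n
  hits≤runCost c S (o ∷ os) =
    +-mono-≤ (≤-trans (recall≤length S (trace c o)) (trace≤cost c o)) (hits≤runCost (perform c o) _ os)

  length-history : ∀ c S os → length (history c S os) ≤ length S + runCost c os
  length-history c S []       = m≤m+n (length S) 0
  length-history c S (o ∷ os) = begin
    length (history (perform c o) (trace c o ++ S) os)
      ≤⟨ length-history (perform c o) (trace c o ++ S) os ⟩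
    length (trace c o ++ S) + rest
      ≡⟨ cong (_+ rest) (trans (length-++ (trace c o)) (+-comm _ (length S))) ⟩
    length S + length (trace c o) + rest
      ≤⟨ +-monoˡ-≤ rest (+-monoʳ-≤ (length S) (trace≤cost c o)) ⟩
    length S + cost c o + rest
      ≡⟨ +-assoc (length S) _ _ ⟩
    length S + (cost c o + rest) ∎
    where
    open ≤-Reasoning
    rest = runCost (perform c o) os

  ∈-history : ∀ c S os {x} → x ∈ S → x ∈ history c S os
  ∈-history c S []       x∈S = x∈S
  ∈-history c S (o ∷ os) x∈S = ∈-history (perform c o) _ os (∈-++⁺ʳ (trace c o) x∈S)

  run-frame : ∀ c S os {x} → x ∉ history c S os → cell (run c os) x ≡ cell c x
  run-frame c S []       x∉ = refl
  run-frame c S (o ∷ os) {x} x∉ = trans (run-frame (perform c o) (trace c o ++ S) os x∉)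
    (frame c o x λ x∈T → x∉ (∈-history (perform c o) (trace c o ++ S) os (∈-++⁺ˡ x∈T)))

  Admissible : Cfg → List Op → Set
  Admissible c []                = ⊤
  Admissible c (update p b ∷ os) = Available c p × Admissible (perform c (update p b)) os
  Admissible c (query q ∷ os)    = Admissible (perform c (query q)) os

  Admissible-++ : ∀ c os os′ → Admissible c os → Admissible (run c os) os′ → Admissible c (os ++ os′)
  Admissible-++ c []                os′ _         ad′ = ad′
  Admissible-++ c (update p b ∷ os) os′ (av , ad) ad′ =
    av , Admissible-++ (perform c (update p b)) os os′ ad ad′
  Admissible-++ c (query q ∷ os)    os′ ad        ad′ = Admissible-++ (perform c (query q)) os os′ ad ad′

  cutsFrom : ℕ → List Op → ℕ
  cutsFrom q []                = 0
  cutsFrom q (update p b ∷ os) = bit (b ∧ (q ≤ᵇ p)) + cutsFrom q os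
  cutsFrom q (query _ ∷ os)    = cutsFrom q os

  cutsFrom-++ : ∀ q os os′ → cutsFrom q (os ++ os′) ≡ cutsFrom q os + cutsFrom q os′
  cutsFrom-++ q []                os′ = refl
  cutsFrom-++ q (update p b ∷ os) os′ rewrite cutsFrom-++ q os os′ =
    sym (+-assoc (bit (b ∧ (q ≤ᵇ p))) _ _)
  cutsFrom-++ q (query _ ∷ os)    os′ = cutsFrom-++ q os os′

  response-run : ∀ c os {q} → Admissible c os → q < N →
                 response (run c os) q + cutsFrom q os ≡ response c q
  response-run c []                    _         q<N = +-identityʳ _
  response-run c (update p b ∷ os) {q} (av , ad) q<N = begin
    response (run c′ os) q + (bit (b ∧ (q ≤ᵇ p)) + cutsFrom q os)
      ≡⟨ cong (response (run c′ os) q +_) (+-comm (bit (b ∧ (q ≤ᵇ p))) _) ⟩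
    response (run c′ os) q + (cutsFrom q os + bit (b ∧ (q ≤ᵇ p)))
      ≡⟨ +-assoc (response (run c′ os) q) _ _ ⟨
    response (run c′ os) q + cutsFrom q os + bit (b ∧ (q ≤ᵇ p))
      ≡⟨ cong (_+ bit (b ∧ (q ≤ᵇ p))) (response-run c′ os ad q<N) ⟩
    response c′ q + bit (b ∧ (q ≤ᵇ p))
      ≡⟨ response-update b q av q<N ⟩
    response c q ∎
    where
    open ≡-Reasoning
    c′ = perform c (update p b)
  response-run c (query q′ ∷ os) {q} ad q<N =
    trans (response-run (perform c (query q′)) os ad q<N) (response-query c q′ q)

  Round : Set
  Round = Bool × ℕ

  rounds : List Round
  rounds = cartesianProduct bools (upTo N)

  ops : ℕ → ℕ → Tree Round a → List Op
  ops p e (leaf (b , q)) = update p b ∷ query q ∷ []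
  ops p e (node l r)     = ops (p + e) (2 * e) l ++ ops p (2 * e) r

  length-ops : ∀ p e (ω : Tree Round a) → length (ops p e ω) ≡ 2 * 2 ^ a
  length-ops p e (leaf _) = refl
  length-ops {suc a} p e (node l r) = begin
    length (ops p e (node l r))   ≡⟨ length-++ (ops (p + e) (2 * e) l) ⟩
    length (ops (p + e) (2 * e) l) + length (ops p (2 * e) r)
      ≡⟨ cong₂ _+_ (length-ops (p + e) (2 * e) l) (length-ops p (2 * e) r) ⟩
    2 * 2 ^ a + 2 * 2 ^ a         ≡⟨ *-distribˡ-+ 2 (2 ^ a) (2 ^ a) ⟨
    2 * (2 ^ a + 2 ^ a)           ≡⟨ cong (λ z → 2 * (2 ^ a + z)) (+-identityʳ (2 ^ a)) ⟨
    2 * (2 * 2 ^ a)               ∎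
    where open ≡-Reasoning

  Free : Cfg → ℕ → ℕ → ℕ → Set
  Free c p e a = ∀ h → h < 2 ^ a → Available c (p + h * e)

  odd-position : ∀ p e h → p + e + h * (2 * e) ≡ p + suc (2 * h) * e
  odd-position = solve-∀

  even-position : ∀ p e h → p + h * (2 * e) ≡ p + 2 * h * e
  even-position = solve-∀

  Free-left : ∀ {c p e} a → Free c p e (suc a) → Free c (p + e) (2 * e) a
  Free-left {c} {p} {e} a free h h< = subst (Available c) (sym (odd-position p e h))
    (free (suc (2 * h)) (≤-trans (≤-reflexive (sym (*-suc 2 h))) (*-monoʳ-≤ 2 h<)))

  Free-right : ∀ {c p e} a → Free c p e (suc a) → Free c p (2 * e) a
  Free-right {c} {p} {e} a free h h< =
    subst (Available c) (sym (even-position p e h)) (free (2 * h) (*-monoʳ-< 2 h<))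

  Available-ops : ∀ {c x} p e (ω : Tree Round a) → (∀ h → x ≢ p + h * e) →
                  Available c x → Available (run c (ops p e ω)) x
  Available-ops p e (leaf (b , q)) x≢ av =
    available-query q (available-update b (λ x≡p → x≢ 0 (trans x≡p (sym (+-identityʳ p)))) av)
  Available-ops {c = c} {x} p e (node l r) x≢ av =
    subst (λ c → Available c x) (sym (run-++ c (ops (p + e) (2 * e) l) _))
      (Available-ops p (2 * e) r (λ h eq → x≢ (2 * h) (trans eq (even-position p e h)))
        (Available-ops (p + e) (2 * e) l (λ h eq → x≢ (suc (2 * h)) (trans eq (odd-position p e h))) av))

  -- The positions of the two halves are multiples of `e` of different parity, counted from `p`, so
  -- the left half never updates a position of the right half. Cancelling `e` takes `0 < e`.
  Free-after-left : ∀ {c p e} → 0 < e → (ω : Tree Round a) → Free c p e (suc a) →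
                    Free (run c (ops (p + e) (2 * e) ω)) p (2 * e) a
  Free-after-left {a = a} {p = p} {e} (s≤s _) ω free h h< =
    Available-ops (p + e) (2 * e) ω distinct (Free-right a free h h<)
    where
    distinct : ∀ k → p + h * (2 * e) ≢ p + e + k * (2 * e)
    distinct k p≡ = even≢odd h k (*-cancelʳ-≡ (2 * h) (suc (2 * k)) e
      (+-cancelˡ-≡ p _ _ (trans (sym (even-position p e h)) (trans p≡ (odd-position p e k)))))

  Admissible-ops : ∀ {c p e} → 0 < e → (ω : Tree Round a) → Free c p e a → Admissible c (ops p e ω)
  Admissible-ops {c = c} {p} {e} 0<e (leaf (b , q)) free =
    subst (Available c) (+-identityʳ p) (free 0 z<s) , _
  Admissible-ops {a = suc a} {c} {p} {e} 0<e (node l r) free =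
    Admissible-++ c (ops (p + e) (2 * e) l) _
      (Admissible-ops 0<2e l (Free-left a free))
      (Admissible-ops 0<2e r (Free-after-left 0<e l free))
    where
    0<2e : 0 < 2 * e
    0<2e = ≤-trans 0<e (m≤m+n e _)

  -- Since `os` does not depend on `y`, its cuts merely lower the constant `κ`; its probes join the
  -- recent list `R`.
  advance : ∀ {Y δ} (F : Family Y δ) os → (∀ y → Admissible (C F y) os) → Family Y δ
  advance {Y} {δ} F os ad = record
    { C         = λ y → run (C F y) os
    ; R         = λ y → history (C F y) (R F y) os
    ; H         = H F
    ; original  = original F
    ; untouched = λ y {x} x∉ → untouched′ y
        (subst (x ∉_) (sym (history-++ˢ (C F y) (R F y) (H F y) os)) x∉)
    ; κ         = λ q → κ F q ∸ cutsFrom q os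
    ; answers   = λ y q q<N → trans (sym (m+n∸n≡m _ (cutsFrom q os)))
        (cong (_∸ cutsFrom q os) (total y q q<N))
    }
    where
    untouched′ : ∀ y {x} → x ∉ history (C F y) (R F y ++ H F y) os →
                 original F x ≡ cell (run (C F y) os) x
    untouched′ y x∉ = trans
      (untouched F y (x∉ ∘ ∈-history (C F y) (R F y ++ H F y) os))
      (sym (run-frame (C F y) (R F y ++ H F y) os x∉))
    total : ∀ y q → q < N → response (run (C F y) os) q + δ q y + cutsFrom q os ≡ κ F q
    total y q q<N = begin
      response (run (C F y) os) q + δ q y + cutsFrom q os
        ≡⟨ rearrange (response (run (C F y) os) q) (δ q y) _ ⟩
      response (run (C F y) os) q + cutsFrom q os + δ q y
        ≡⟨ cong (_+ δ q y) (response-run (C F y) os (ad y) q<N) ⟩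
      response (C F y) q + δ q y
        ≡⟨ answers F y q q<N ⟩
      κ F q ∎
      where
      open ≡-Reasoning
      rearrange : ∀ i j k → i + j + k ≡ i + k + j
      rearrange = solve-∀

  -- Marks the start of a sub-block: all probes so far become old ones.
  forget : ∀ {Y δ} → Family Y δ → Family Y δ
  forget F = record
    { C         = C F
    ; R         = λ _ → []
    ; H         = λ y → R F y ++ H F y
    ; original  = original F
    ; untouched = untouched F
    ; κ         = κ F
    ; answers   = answers F
    }

  -- The counting argument for a single query after a left half of `8 * u` bits.

  module Level {p e u m b} (p<e : p < e) (N≡ : N ≡ leaves b * (2 * e)) (8u≡ : leaves b ≡ 8 * u)
               (few : 2 * length (summaries s r m) ≤ 8 ^ u) where

    Ys : List (Tree Bool b)
    Ys = trees bools b

    δ : ℕ → Tree Bool b → ℕ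
    δ q = cuts (q ≤ᵇ_) (p + e) (2 * e)

    module Core (F : Family (Tree Bool b) δ) where

      T-of : Tree Bool b → ℕ → List (Fin s)
      T-of y q = trace (C F y) (query q)

      old : ℕ → Tree Bool b → ℕ
      old q y = stale (R F y) (H F y) (T-of y q)

      -- A summary must determine its guesses without knowledge of `y`, so one amount of fuel has to
      -- suffice for all `y` and `q`; the sum of all costs does.
      fuel : ℕ
      fuel = ∑[ y ← Ys ] (∑[ q ← upTo N ] cost (C F y) (query q))

      cost≤fuel : ∀ y {q} → q < N → cost (C F y) (query q) ≤ fuel
      cost≤fuel y q<N =
        ≤-trans (∑-∈ _ (∈-upTo⁺ q<N)) (∑-∈ (λ y → ∑[ q ← upTo N ] cost (C F y) (query q)) (∈-trees all y))
        where
        all : ∀ b → b ∈ bools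
        all true  = here refl
        all false = there (here refl)

      module Offset {d} (d<e : d < e) where

        q : ℕ → ℕ
        q h = h * (2 * e) + d

        q<N : ∀ {h} → h < leaves b → q h < N
        q<N {h} h<l = begin-strict
          h * (2 * e) + d      <⟨ +-monoʳ-< (h * (2 * e)) (<-≤-trans d<e (m≤m+n e (e + 0))) ⟩
          h * (2 * e) + 2 * e  ≡⟨ +-comm _ (2 * e) ⟩
          suc h * (2 * e)      ≤⟨ *-monoˡ-≤ (2 * e) h<l ⟩
          leaves b * (2 * e)   ≡⟨ N≡ ⟨
          N                    ∎
          where open ≤-Reasoning

        -- The position for `k = h` is `h * (2 * e) + (p + e)`, and `d < e ≤ p + e < 2 * e`; so
        -- `q h` lies at or below it, but above the position for `h - 1`.
        separates : ∀ h k → (q h ≤ᵇ p + e + k * (2 * e)) ≡ (h ≤ᵇ k)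
        separates h k with h ≤? k
        ... | yes h≤k = trans (≤⇒≤ᵇ≡true above) (sym (≤⇒≤ᵇ≡true h≤k))
          where
          ≤⇒≤ᵇ≡true : ∀ {m n} → m ≤ n → (m ≤ᵇ n) ≡ true
          ≤⇒≤ᵇ≡true {m} {n} m≤n with m ≤ᵇ n | ≤⇒≤ᵇ m≤n
          ... | true | _ = refl
          above : q h ≤ p + e + k * (2 * e)
          above = begin
            h * (2 * e) + d      ≤⟨ +-mono-≤ (*-monoˡ-≤ (2 * e) h≤k) (<⇒≤ d<e) ⟩
            k * (2 * e) + e      ≡⟨ +-comm (k * (2 * e)) e ⟩
            e + k * (2 * e)      ≤⟨ +-monoˡ-≤ (k * (2 * e)) (m≤n+m e p) ⟩
            p + e + k * (2 * e)  ∎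
            where open ≤-Reasoning
        ... | no h≰k = trans (≰⇒≤ᵇ≡false (<⇒≱ below)) (sym (≰⇒≤ᵇ≡false h≰k))
          where
          ≰⇒≤ᵇ≡false : ∀ {m n} → ¬ m ≤ n → (m ≤ᵇ n) ≡ false
          ≰⇒≤ᵇ≡false {m} {n} m≰n with m ≤ᵇ n in eq
          ... | true  = contradiction (≤ᵇ⇒≤ m n (subst T (sym eq) _)) m≰n
          ... | false = refl
          below : p + e + k * (2 * e) < q h
          below = begin-strict
            p + e + k * (2 * e)    <⟨ +-monoˡ-< (k * (2 * e)) (+-monoˡ-< e p<e) ⟩
            e + e + k * (2 * e)    ≡⟨ cong (λ z → e + z + k * (2 * e)) (+-identityʳ e) ⟨
            suc k * (2 * e)        ≤⟨ *-monoˡ-≤ (2 * e) (≰⇒> h≰k) ⟩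
            h * (2 * e)            ≤⟨ m≤m+n _ d ⟩
            q h                    ∎
            where open ≤-Reasoning

        guess : Summary s r m → ℕ → ℕ
        guess (ρ , μ) h = simulate fuel ρ (patch μ (original F)) (q h)

        -- The exponential moment of the union bound: at least `3 ^ (7 * u)` if the guesses from `π`
        -- are right in `7 * u` places, yet for fixed `π` its sum over all `y` is at most
        -- `4 ^ (8 * u)`.
        weight : Summary s r m → Tree Bool b → ℕ
        weight π y = 3 ^ agree (guess π) (κ F ∘ q) (positional y)

        summary : Tree Bool b → Summary s r m
        summary y = registers (C F y) , contents address₀ m (cell (C F y)) (R F y)

        olds : Tree Bool b → ℕ
        olds y = ∑[ h ← upTo (leaves b) ] old (q h) y

        -- A query without stale probes reads only cells in `R`, whose contents the summary lists,
        -- and cells that no probe has touched since before the bits were used. So its simulation is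
        -- faithful, and only queries with stale probes can spoil a guess.
        mostly-right : ∀ y → length (R F y) ≤ m →
                       8 * u ≤ agree (guess (summary y)) (κ F ∘ q) (positional y) + olds y
        mostly-right y len = subst (_≤ agree (guess (summary y)) (κ F ∘ q) (positional y) + olds y) 8u≡
          (agree-all (guess (summary y)) (κ F ∘ q) (λ h → old (q h) y) (positional y) right)
          where
          right : ∀ h → h < leaves b → old (q h) y ≡ 0 →
                  guess (summary y) h + countWith (h ≤ᵇ_) (positional y) ≡ κ F (q h)
          right h h<l none = trans
            (cong₂ _+_ simulated
               (sym (trans (cuts-positional (q h ≤ᵇ_) (p + e) (2 * e) y)
                           (countWith-cong (separates h) (positional y)))))
            (answers F y (q h) (q<N h<l))
            where
            simulated : guess (summary y) h ≡ response (C F y) (q h)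
            simulated = simulate-correct (cost≤fuel y (q<N h<l)) (q<N h<l) λ {x} x∈T →
              patch-contents address₀ m (original F) (cell (C F y)) (R F y) x len λ x∉R →
                untouched F y (x∉R ∘ stale-free (R F y) (H F y) (T-of y (q h)) none x∈T)

        K : ℕ
        K = 3 ^ (7 * u)

        -- Markov's inequality for three events at once: many recent probes, many stale probes, or
        -- `7 * u` right guesses. The coefficients make each event worth `m * u * K`.
        pointwise : ∀ y → m * u * K ≤
                    u * K * length (R F y) + m * K * olds y + m * u * weight (summary y) y
        pointwise y with m ≤? length (R F y) | u ≤? olds y
        ... | yes m≤R | _ = begin
          m * u * K                                   ≡⟨ lemma m u K ⟩
          u * K * m                                   ≤⟨ *-monoʳ-≤ (u * K) m≤R ⟩
          u * K * length (R F y)                      ≤⟨ m≤m+n _ _ ⟩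
          u * K * length (R F y) + m * K * olds y     ≤⟨ m≤m+n _ _ ⟩
          _                                           ∎
          where
          open ≤-Reasoning
          lemma : ∀ m u K → m * u * K ≡ u * K * m
          lemma = solve-∀
        ... | no _ | yes u≤olds = begin
          m * u * K                                   ≡⟨ lemma m u K ⟩
          m * K * u                                   ≤⟨ *-monoʳ-≤ (m * K) u≤olds ⟩
          m * K * olds y                              ≤⟨ m≤n+m _ _ ⟩
          u * K * length (R F y) + m * K * olds y     ≤⟨ m≤m+n _ _ ⟩
          _                                           ∎
          where
          open ≤-Reasoning
          lemma : ∀ m u K → m * u * K ≡ m * K * u
          lemma = solve-∀
        ... | no m≰R | no u≰olds = ≤-trans (*-monoʳ-≤ (m * u) (^-monoʳ-≤ 3 agreement)) (m≤n+m _ _)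
          where
          agreement : 7 * u ≤ agree (guess (summary y)) (κ F ∘ q) (positional y)
          agreement = +-cancelʳ-≤ u _ _ (begin
            7 * u + u   ≡⟨ +-comm (7 * u) u ⟩
            8 * u       ≤⟨ mostly-right y (<⇒≤ (≰⇒> m≰R)) ⟩
            _ + olds y  ≤⟨ +-monoʳ-≤ _ (<⇒≤ (≰⇒> u≰olds)) ⟩
            _ + u       ∎)
            where open ≤-Reasoning

        length-Ys : length Ys ≡ 2 ^ (8 * u)
        length-Ys = trans (length-trees bools b) (cong (2 ^_) 8u≡)

        total-weight : 2 * (∑[ y ← Ys ] weight (summary y) y) ≤ length Ys * K
        total-weight = begin
          2 * (∑[ y ← Ys ] weight (summary y) y)
            -- The union bound: after passing to all summaries, `π` no longer depends on `y`.
            ≤⟨ *-monoʳ-≤ 2 (∑-mono Ys λ y → ∑-∈ {xs = Π} (λ π → weight π y) (∈-summaries (summary y))) ⟩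
          2 * (∑[ y ← Ys ] (∑[ π ← Π ] weight π y))
            ≡⟨ cong (2 *_) (∑-swap Ys Π (λ y π → weight π y)) ⟩
          2 * (∑[ π ← Π ] (∑[ y ← Ys ] weight π y))
            ≡⟨ cong (2 *_) (∑-cong Π λ π →
                 ∑-positional bools b (λ v → 3 ^ agree (guess π) (κ F ∘ q) v)) ⟩
          2 * (∑[ π ← Π ] (∑[ v ← vecs bools (leaves b) ] 3 ^ agree (guess π) (κ F ∘ q) v))
            ≤⟨ *-monoʳ-≤ 2 (∑-mono Π λ π → ∑-3^agree (leaves b) (guess π) (κ F ∘ q)) ⟩
          2 * (∑[ π ← Π ] 4 ^ leaves b)
            ≡⟨ cong (2 *_) (∑-const Π _) ⟩
          2 * (length Π * 4 ^ leaves b)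
            ≡⟨ *-assoc 2 (length Π) _ ⟨
          2 * length Π * 4 ^ leaves b
            ≤⟨ *-monoˡ-≤ (4 ^ leaves b) few ⟩
          8 ^ u * 4 ^ leaves b
            ≡⟨ cong (λ l → 8 ^ u * 4 ^ l) 8u≡ ⟩
          8 ^ u * 4 ^ (8 * u)
            ≡⟨ cong (8 ^ u *_) (^-*-assoc 4 8 u) ⟨
          8 ^ u * (4 ^ 8) ^ u
            ≡⟨ ^-distribʳ-* u 8 (4 ^ 8) ⟨
          (8 * 4 ^ 8) ^ u
            -- Here the base 3 and the ratio 7 : 8 are seen to fit together: 524288 ≤ 559872.
            ≤⟨ ^-monoˡ-≤ u (≤ᵇ⇒≤ (8 * 4 ^ 8) (2 ^ 8 * 3 ^ 7) _) ⟩
          (2 ^ 8 * 3 ^ 7) ^ u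
            ≡⟨ ^-distribʳ-* u (2 ^ 8) (3 ^ 7) ⟩
          (2 ^ 8) ^ u * (3 ^ 7) ^ u
            ≡⟨ cong₂ _*_ (^-*-assoc 2 8 u) (^-*-assoc 3 7 u) ⟩
          2 ^ (8 * u) * K
            ≡⟨ cong (_* K) length-Ys ⟨
          length Ys * K ∎
          where
          open ≤-Reasoning
          Π = summaries s r m

        -- By `total-weight` the third event of `pointwise` covers at most half of the total; the
        -- other two must pay for the rest.
        offset-bound : m * u * length Ys ≤ 2 * u * ∑ Ys (length ∘ R F) + 2 * m * ∑ Ys olds
        offset-bound = *-cancelʳ-≤ _ _ K {{m^n≢0 3 (7 * u)}} (+-cancelʳ-≤ (m * u * (length Ys * K)) _ _ (begin
          m * u * length Ys * K + m * u * (length Ys * K)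
            ≡⟨ lemma₁ m u K (length Ys) ⟩
          2 * (length Ys * (m * u * K))
            ≡⟨ cong (2 *_) (∑-const Ys _) ⟨
          2 * (∑[ y ← Ys ] m * u * K)
            ≤⟨ *-monoʳ-≤ 2 (∑-mono Ys pointwise) ⟩
          2 * (∑[ y ← Ys ] (u * K * length (R F y) + m * K * olds y + m * u * weight (summary y) y))
            ≡⟨ cong (2 *_) (trans (∑-+ Ys _ _) (cong₂ _+_
                 (trans (∑-+ Ys _ _) (cong₂ _+_ (∑-* Ys (u * K) _) (∑-* Ys (m * K) _)))
                 (∑-* Ys (m * u) _))) ⟩
          2 * (u * K * ∑ Ys (length ∘ R F) + m * K * ∑ Ys olds + m * u * W)
            ≡⟨ lemma₂ m u K (∑ Ys (length ∘ R F)) (∑ Ys olds) W ⟩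
          (2 * u * ∑ Ys (length ∘ R F) + 2 * m * ∑ Ys olds) * K + m * u * (2 * W)
            ≤⟨ +-monoʳ-≤ _ (*-monoʳ-≤ (m * u) total-weight) ⟩
          (2 * u * ∑ Ys (length ∘ R F) + 2 * m * ∑ Ys olds) * K + m * u * (length Ys * K) ∎))
          where
          open ≤-Reasoning
          W = ∑[ y ← Ys ] weight (summary y) y
          lemma₁ : ∀ m u K l → m * u * l * K + m * u * (l * K) ≡ 2 * (l * (m * u * K))
          lemma₁ = solve-∀
          lemma₂ : ∀ m u K i j k → 2 * (u * K * i + m * K * j + m * u * k) ≡
                   (2 * u * i + 2 * m * j) * K + m * u * (2 * k)
          lemma₂ = solve-∀

      fresh-probes : m * u * length Ys * e ≤
                     2 * u * ∑ Ys (length ∘ R F) * e + 2 * m * (∑[ q ← upTo N ] ∑ Ys (old q))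
      fresh-probes = begin
        m * u * length Ys * e
          ≡⟨ trans (*-comm _ e) (sym (∑-const-upTo e _)) ⟩
        ∑[ d ← upTo e ] m * u * length Ys
          ≤⟨ ∑-mono-∈ (upTo e) (λ d∈ → Offset.offset-bound (∈-upTo⁻ d∈)) ⟩
        ∑[ d ← upTo e ] (2 * u * ∑ Ys (length ∘ R F) + 2 * m * ∑ Ys (oldsAt d))
          ≡⟨ trans (∑-+ (upTo e) _ _)
                   (cong₂ _+_ (trans (∑-const-upTo e _) (*-comm e _)) (∑-* (upTo e) (2 * m) _)) ⟩
        2 * u * ∑ Ys (length ∘ R F) * e + 2 * m * (∑[ d ← upTo e ] ∑ Ys (oldsAt d))
          ≤⟨ +-monoʳ-≤ _ (*-monoʳ-≤ (2 * m) collect) ⟩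
        2 * u * ∑ Ys (length ∘ R F) * e + 2 * m * (∑[ q ← upTo N ] ∑ Ys (old q)) ∎
        where
        open ≤-Reasoning
        oldsAt : ℕ → Tree Bool b → ℕ
        oldsAt d y = ∑[ h ← upTo (leaves b) ] old (h * (2 * e) + d) y
        collect : ∑[ d ← upTo e ] ∑ Ys (oldsAt d) ≤ ∑[ q ← upTo N ] ∑ Ys (old q)
        collect = begin
          ∑[ d ← upTo e ] (∑[ y ← Ys ] (∑[ h ← upTo (leaves b) ] old (h * (2 * e) + d) y))
            ≡⟨ (∑-cong (upTo e) λ d → ∑-swap Ys (upTo (leaves b)) λ y h → old (h * (2 * e) + d) y) ⟩
          ∑[ d ← upTo e ] (∑[ h ← upTo (leaves b) ] ∑ Ys (old (h * (2 * e) + d)))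
            ≡⟨ ∑-swap (upTo e) (upTo (leaves b)) (λ d h → ∑ Ys (old (h * (2 * e) + d))) ⟩
          ∑[ h ← upTo (leaves b) ] (∑[ d ← upTo e ] ∑ Ys (old (h * (2 * e) + d)))
            -- The offsets from `e` to `2 * e`, for which `separates` makes no claim, are added for
            -- free.
            ≤⟨ (∑-mono (upTo (leaves b)) λ h → ≤-trans (m≤m+n _ _)
                 (≤-reflexive (sym (∑-upTo-+ e (e + 0) λ d → ∑ Ys (old (h * (2 * e) + d)))))) ⟩
          ∑[ h ← upTo (leaves b) ] (∑[ d ← upTo (2 * e) ] ∑ Ys (old (h * (2 * e) + d)))
            ≡⟨ ∑-upTo-* (leaves b) (2 * e) (λ q → ∑ Ys (old q)) ⟨
          ∑[ q ← upTo (leaves b * (2 * e)) ] ∑ Ys (old q)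
            ≡⟨ cong (λ k → ∑[ q ← upTo k ] ∑ Ys (old q)) N≡ ⟨
          ∑[ q ← upTo N ] ∑ Ys (old q) ∎

      -- The factor 32 is 2 from `offset-bound` times 16 from `N ≡ 8 * u * (2 * e)`. Adding the
      -- recall of `R` to both sides turns stale probes into a difference of two recalls.
      core : ∑[ q ← upTo N ] (∑[ y ← Ys ] (m + 32 * m * recall (R F y) (T-of y q))) ≤
             ∑[ q ← upTo N ] (∑[ y ← Ys ] (32 * m * recall (R F y ++ H F y) (T-of y q) + 2 * length (R F y)))
      core = begin
        ∑[ q ← upTo N ] (∑[ y ← Ys ] (m + known q y))
          ≡⟨ (∑∑-split (λ _ _ → m) known) ⟩
        (∑[ q ← upTo N ] (∑[ y ← Ys ] m)) + K
          ≡⟨ cong (_+ K) (trans (∑-const-upTo N _) (cong (N *_) (∑-const Ys m))) ⟩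
        N * (length Ys * m) + K
          ≤⟨ +-monoˡ-≤ K main ⟩
        32 * m * O + N * (2 * L) + K
          ≡⟨ cong₂ (λ i j → i + j + K) (sym (∑∑-* (32 * m) old))
               (sym (trans (∑-const-upTo N _) (cong (N *_) (∑-* Ys 2 _)))) ⟩
        (∑[ q ← upTo N ] (∑[ y ← Ys ] 32 * m * old q y)) + (∑[ q ← upTo N ] (∑[ y ← Ys ] 2 * length (R F y))) + K
          ≡⟨ trans (∑∑-split (λ q y → 32 * m * old q y + 2 * length (R F y)) known)
                   (cong (_+ K) (∑∑-split (λ q y → 32 * m * old q y) λ q y → 2 * length (R F y))) ⟨
        ∑[ q ← upTo N ] (∑[ y ← Ys ] (32 * m * old q y + 2 * length (R F y) + known q y))
          ≡⟨ (∑-cong (upTo N) λ q → ∑-cong Ys λ y → regroup q y) ⟩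
        ∑[ q ← upTo N ] (∑[ y ← Ys ] (32 * m * recall (R F y ++ H F y) (T-of y q) + 2 * length (R F y))) ∎
        where
        open ≤-Reasoning
        known : ℕ → Tree Bool b → ℕ
        known q y = 32 * m * recall (R F y) (T-of y q)
        K = ∑[ q ← upTo N ] ∑ Ys (known q)
        O = ∑[ q ← upTo N ] ∑ Ys (old q)
        L = ∑ Ys (length ∘ R F)
        ∑∑-split : ∀ (f g : ℕ → Tree Bool b → ℕ) →
               ∑[ q ← upTo N ] (∑[ y ← Ys ] (f q y + g q y)) ≡
               (∑[ q ← upTo N ] ∑ Ys (f q)) + (∑[ q ← upTo N ] ∑ Ys (g q))
        ∑∑-split f g = trans (∑-cong (upTo N) λ q → ∑-+ Ys (f q) (g q)) (∑-+ (upTo N) _ _)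
        ∑∑-* : ∀ k (f : ℕ → Tree Bool b → ℕ) →
               ∑[ q ← upTo N ] (∑[ y ← Ys ] k * f q y) ≡ k * (∑[ q ← upTo N ] ∑ Ys (f q))
        ∑∑-* k f = trans (∑-cong (upTo N) λ q → ∑-* Ys k (f q)) (∑-* (upTo N) k _)
        regroup : ∀ q y → 32 * m * old q y + 2 * length (R F y) + known q y ≡
                  32 * m * recall (R F y ++ H F y) (T-of y q) + 2 * length (R F y)
        regroup q y rewrite recall-++ (R F y) (H F y) (T-of y q) =
          lemma m (old q y) (length (R F y)) (recall (R F y) (T-of y q))
          where
          lemma : ∀ m i j k → 32 * m * i + 2 * j + 32 * m * k ≡ 32 * m * (k + i) + 2 * j
          lemma = solve-∀
        main : N * (length Ys * m) ≤ 32 * m * O + N * (2 * L)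
        main = begin
          N * (length Ys * m)
            ≡⟨ cong (_* (length Ys * m)) N≡16ue ⟩
          8 * u * (2 * e) * (length Ys * m)
            ≡⟨ lemma₁ u e m (length Ys) ⟩
          16 * (m * u * length Ys * e)
            ≤⟨ *-monoʳ-≤ 16 fresh-probes ⟩
          16 * (2 * u * L * e + 2 * m * O)
            ≡⟨ lemma₂ u e m L O ⟩
          32 * m * O + 8 * u * (2 * e) * (2 * L)
            ≡⟨ cong (λ k → 32 * m * O + k * (2 * L)) N≡16ue ⟨
          32 * m * O + N * (2 * L) ∎
          where
          N≡16ue : N ≡ 8 * u * (2 * e)
          N≡16ue = trans N≡ (cong (_* (2 * e)) 8u≡)
          lemma₁ : ∀ u e m l → 8 * u * (2 * e) * (l * m) ≡ 16 * (m * u * l * e)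
          lemma₁ = solve-∀
          lemma₂ : ∀ u e m l o → 16 * (2 * u * l * e + 2 * m * o) ≡ 32 * m * o + 8 * u * (2 * e) * (2 * l)
          lemma₂ = solve-∀

-- From one query to all rounds of a sub-block.

module Averages {N s r : ℕ} (Mach : Machine N s r) where
  open Machine Mach
  open LowerBound Mach
  open Family

  Ω : ∀ a → List (Tree Round a)
  Ω = trees rounds

  0<2* : ∀ {e} → 0 < e → 0 < 2 * e
  0<2* 0<e = ≤-trans 0<e (m≤m+n _ _)

  module Transfer {p e u m b} (p<e : p < e) (N≡ : N ≡ leaves b * (2 * e)) (8u≡ : leaves b ≡ 8 * u)
                  (few : 2 * length (summaries s r m) ≤ 8 ^ u) where
    open Level {p} {e} {u} {m} {b} p<e N≡ 8u≡ few public

    module _ (F : Family (Tree Bool b) δ) (p′ e′ : ℕ) where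

      gain spent : ∀ d → Tree Round d → Tree Bool b → ℕ
      gain  d ω y = m * 2 ^ d + 32 * m * hits (C F y) (R F y) (ops p′ e′ ω)
      spent d ω y = 32 * m * hits (C F y) (R F y ++ H F y) (ops p′ e′ ω) +
                    2 * (2 ^ d * (length (R F y) + runCost (C F y) (ops p′ e′ ω)))

    -- In each round `core` charges the length of `R`, which never exceeds its initial length plus
    -- the cost of the whole sub-block; hence the factor `2 ^ d` in `spent`.
    transfer : ∀ d F p′ e′ → 0 < e′ → (∀ y → Free (C F y) p′ e′ d) →
               ∑[ ω ← Ω d ] ∑ Ys (gain F p′ e′ d ω) ≤ ∑[ ω ← Ω d ] ∑ Ys (spent F p′ e′ d ω)
    transfer zero F p′ e′ 0<e′ free = begin
      ∑[ ω ← Ω 0 ] ∑ Ys (gain F p′ e′ 0 ω)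
        ≡⟨ by-round (λ ω → ∑ Ys (gain F p′ e′ 0 ω)) ⟩
      ∑[ β ← bools ] (∑[ q ← upTo N ] ∑ Ys (gain F p′ e′ 0 (leaf (β , q))))
        ≤⟨ ∑-mono bools at ⟩
      ∑[ β ← bools ] (∑[ q ← upTo N ] ∑ Ys (spent F p′ e′ 0 (leaf (β , q))))
        ≡⟨ by-round (λ ω → ∑ Ys (spent F p′ e′ 0 ω)) ⟨
      ∑[ ω ← Ω 0 ] ∑ Ys (spent F p′ e′ 0 ω) ∎
      where
      open ≤-Reasoning
      by-round : ∀ f → ∑ (Ω 0) f ≡ ∑[ β ← bools ] (∑[ q ← upTo N ] f (leaf (β , q)))
      by-round f = trans (∑-map rounds leaf f) (∑-product _,_ bools (upTo N) _)
      at : ∀ β → ∑[ q ← upTo N ] ∑ Ys (gain F p′ e′ 0 (leaf (β , q))) ≤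
                 ∑[ q ← upTo N ] ∑ Ys (spent F p′ e′ 0 (leaf (β , q)))
      at β = begin
        ∑[ q ← upTo N ] ∑ Ys (gain F p′ e′ 0 (leaf (β , q)))
          ≡⟨ (∑-cong (upTo N) λ q → trans (∑-cong Ys λ y → split-gain q y) (∑-+ Ys _ _)) ⟩
        ∑[ q ← upTo N ] (∑ Ys before + ∑ Ys (λ y → m + 32 * m * recall (R F₁ y) (T-of y q)))
          ≡⟨ ∑-+ (upTo N) _ _ ⟩
        (∑[ q ← upTo N ] ∑ Ys before) +
        (∑[ q ← upTo N ] (∑[ y ← Ys ] (m + 32 * m * recall (R F₁ y) (T-of y q))))
          -- `core` concerns the query alone. The recalls of the update before it are added to both
          -- sides, and later enlarged from `R` to `R ++ H`.
          ≤⟨ +-monoʳ-≤ (∑[ q ← upTo N ] ∑ Ys before) core ⟩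
        (∑[ q ← upTo N ] ∑ Ys before) +
        (∑[ q ← upTo N ] (∑[ y ← Ys ] (32 * m * recall (R F₁ y ++ H F₁ y) (T-of y q) + 2 * length (R F₁ y))))
          ≡⟨ ∑-+ (upTo N) _ _ ⟨
        ∑[ q ← upTo N ] (∑ Ys before + ∑ Ys (λ y → 32 * m * recall (R F₁ y ++ H F₁ y) (T-of y q) + 2 * length (R F₁ y)))
          ≤⟨ (∑-mono (upTo N) λ q → ≤-trans (≤-reflexive (sym (∑-+ Ys _ _)))
               (∑-mono Ys λ y → merge-spent q y)) ⟩
        ∑[ q ← upTo N ] ∑ Ys (spent F p′ e′ 0 (leaf (β , q))) ∎
        where
        o = update p′ β
        F₁ : Family (Tree Bool b) δ
        F₁ = advance F (o ∷ []) λ y → subst (Available (C F y)) (+-identityʳ p′) (free y 0 z<s) , _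
        open Core F₁
        before : Tree Bool b → ℕ
        before y = 32 * m * recall (R F y) (trace (C F y) o)
        split-gain : ∀ q y → gain F p′ e′ 0 (leaf (β , q)) y ≡
                     before y + (m + 32 * m * recall (R F₁ y) (T-of y q))
        split-gain q y = lemma m (recall (R F y) (trace (C F y) o)) (recall (R F₁ y) (T-of y q))
          where
          lemma : ∀ m i j → m * 1 + 32 * m * (i + (j + 0)) ≡ 32 * m * i + (m + 32 * m * j)
          lemma = solve-∀
        merge-spent : ∀ q y → before y + (32 * m * recall (R F₁ y ++ H F₁ y) (T-of y q) + 2 * length (R F₁ y)) ≤
                      spent F p′ e′ 0 (leaf (β , q)) y
        merge-spent q y = begin
          32 * m * recall (R F y) tr + (32 * m * later + 2 * length (R F₁ y))
            ≡⟨ +-assoc (32 * m * recall (R F y) tr) _ _ ⟨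
          32 * m * recall (R F y) tr + 32 * m * later + 2 * length (R F₁ y)
            ≤⟨ +-mono-≤
                 (+-monoˡ-≤ (32 * m * later) (*-monoʳ-≤ (32 * m) (recall-mono (R F y) (H F y) tr)))
                 (*-monoʳ-≤ 2 short) ⟩
          32 * m * recall (R F y ++ H F y) tr + 32 * m * later +
          2 * (length (R F y) + (cost (C F y) o + cost (C F₁ y) (query q)))
            ≡⟨ lemma m (recall (R F y ++ H F y) tr) later (length (R F y)) (cost (C F y) o) _ ⟩
          32 * m * (recall (R F y ++ H F y) tr + (later + 0)) +
          2 * (1 * (length (R F y) + (cost (C F y) o + (cost (C F₁ y) (query q) + 0))))
            ≡⟨ cong (λ S → 32 * m * (recall (R F y ++ H F y) tr + (recall S (T-of y q) + 0)) + 2 * (1 * (length (R F y) + (cost (C F y) o + (cost (C F₁ y) (query q) + 0)))))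
                    (++-assoc tr (R F y) (H F y)) ⟩
          spent F p′ e′ 0 (leaf (β , q)) y ∎
          where
          tr    = trace (C F y) o
          later = recall (R F₁ y ++ H F₁ y) (T-of y q)
          short : length (R F₁ y) ≤ length (R F y) + (cost (C F y) o + cost (C F₁ y) (query q))
          short = begin
            length (tr ++ R F y)                ≡⟨ trans (length-++ tr) (+-comm (length tr) _) ⟩
            length (R F y) + length tr          ≤⟨ +-monoʳ-≤ (length (R F y))
                                                     (≤-trans (trace≤cost (C F y) o) (m≤m+n _ _)) ⟩
            length (R F y) + (cost (C F y) o + cost (C F₁ y) (query q)) ∎
          lemma : ∀ m i j k c c′ → 32 * m * i + 32 * m * j + 2 * (k + (c + c′)) ≡
                  32 * m * (i + (j + 0)) + 2 * (1 * (k + (c + (c′ + 0))))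
          lemma = solve-∀
    transfer (suc d) F p′ e′ 0<e′ free = begin
      ∑[ ω ← Ω (suc d) ] ∑ Ys (gain F p′ e′ (suc d) ω)
        ≡⟨ ∑-product node (Ω d) (Ω d) _ ⟩
      ∑[ l ← Ω d ] (∑[ r ← Ω d ] ∑ Ys (gain F p′ e′ (suc d) (node l r)))
        ≡⟨ (∑-cong (Ω d) λ l → ∑-cong (Ω d) λ r →
             trans (∑-cong Ys λ y → split-gain l r y) (∑-+ Ys _ _)) ⟩
      ∑[ l ← Ω d ] (∑[ r ← Ω d ] (∑ Ys (gain F pˡ eˡ d l) + ∑ Ys (gain (F₁ l) p′ eˡ d r)))
        ≤⟨ ∑∑-+-mono (Ω d) (Ω d) _ _ _ _
             (transfer d F pˡ eˡ (0<2* 0<e′) (λ y → Free-left d (free y)))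
             (∑-mono (Ω d) λ l → transfer d (F₁ l) p′ eˡ (0<2* 0<e′)
               (λ y → Free-after-left 0<e′ l (free y))) ⟩
      ∑[ l ← Ω d ] (∑[ r ← Ω d ] (∑ Ys (spent F pˡ eˡ d l) + ∑ Ys (spent (F₁ l) p′ eˡ d r)))
        ≤⟨ (∑-mono (Ω d) λ l → ∑-mono (Ω d) λ r →
             ≤-trans (≤-reflexive (sym (∑-+ Ys _ _))) (∑-mono Ys λ y → merge-spent l r y)) ⟩
      ∑[ l ← Ω d ] (∑[ r ← Ω d ] ∑ Ys (spent F p′ e′ (suc d) (node l r)))
        ≡⟨ ∑-product node (Ω d) (Ω d) _ ⟨
      ∑[ ω ← Ω (suc d) ] ∑ Ys (spent F p′ e′ (suc d) ω) ∎
      where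
      open ≤-Reasoning
      pˡ = p′ + e′
      eˡ = 2 * e′
      F₁ : Tree Round d → Family (Tree Bool b) δ
      F₁ l = advance F (ops pˡ eˡ l) λ y → Admissible-ops (0<2* 0<e′) l (Free-left d (free y))
      split-gain : ∀ l r y → gain F p′ e′ (suc d) (node l r) y ≡
                   gain F pˡ eˡ d l y + gain (F₁ l) p′ eˡ d r y
      split-gain l r y rewrite hits-++ (C F y) (R F y) (ops pˡ eˡ l) (ops p′ eˡ r) =
        lemma m (2 ^ d) (hits (C F y) (R F y) (ops pˡ eˡ l)) _
        where
        lemma : ∀ m t i j → m * (2 * t) + 32 * m * (i + j) ≡ m * t + 32 * m * i + (m * t + 32 * m * j)
        lemma = solve-∀
      merge-spent : ∀ l r y → spent F pˡ eˡ d l y + spent (F₁ l) p′ eˡ d r y ≤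
                    spent F p′ e′ (suc d) (node l r) y
      merge-spent l r y
        rewrite hits-++ (C F y) (R F y ++ H F y) (ops pˡ eˡ l) (ops p′ eˡ r)
              | runCost-++ (C F y) (ops pˡ eˡ l) (ops p′ eˡ r)
              | history-++ˢ (C F y) (R F y) (H F y) (ops pˡ eˡ l) = begin
        32 * m * h₁ + 2 * (t * (ρ + c₁)) + (32 * m * h₂ + 2 * (t * (length (R (F₁ l) y) + c₂)))
          ≤⟨ +-monoʳ-≤ (32 * m * h₁ + 2 * (t * (ρ + c₁))) (+-monoʳ-≤ (32 * m * h₂) (*-monoʳ-≤ 2 (*-monoʳ-≤ t
               (+-monoˡ-≤ c₂ (length-history (C F y) (R F y) (ops pˡ eˡ l)))))) ⟩
        32 * m * h₁ + 2 * (t * (ρ + c₁)) + (32 * m * h₂ + 2 * (t * (ρ + c₁ + c₂)))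
          ≤⟨ m≤m+n _ (2 * (t * c₂)) ⟩
        32 * m * h₁ + 2 * (t * (ρ + c₁)) + (32 * m * h₂ + 2 * (t * (ρ + c₁ + c₂))) + 2 * (t * c₂)
          ≡⟨ lemma m t ρ h₁ h₂ c₁ c₂ ⟩
        32 * m * (h₁ + h₂) + 2 * (2 * t * (ρ + (c₁ + c₂))) ∎
        where
        t  = 2 ^ d
        ρ  = length (R F y)
        h₁ = hits (C F y) (R F y ++ H F y) (ops pˡ eˡ l)
        h₂ = hits (run (C F y) (ops pˡ eˡ l)) (history (C F y) (R F y) (ops pˡ eˡ l) ++ H F y) (ops p′ eˡ r)
        c₁ = runCost (C F y) (ops pˡ eˡ l)
        c₂ = runCost (run (C F y) (ops pˡ eˡ l)) (ops p′ eˡ r)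
        lemma : ∀ m t ρ h₁ h₂ c₁ c₂ →
          32 * m * h₁ + 2 * (t * (ρ + c₁)) + (32 * m * h₂ + 2 * (t * (ρ + c₁ + c₂))) + 2 * (t * c₂) ≡
          32 * m * (h₁ + h₂) + 2 * (2 * t * (ρ + (c₁ + c₂)))
        lemma = solve-∀

-- Induction over the levels.

module Levels {N s r : ℕ} (Mach : Machine N s r) (M g₂ : ℕ)
              (few : ∀ k → 2 * length (summaries s r (M * 2 ^ k)) ≤ 8 ^ (2 ^ g₂ * 2 ^ k)) where
  open Machine Mach
  open LowerBound Mach
  open Averages Mach
  open Family

  -- The left half of a block of level `suc j` has `2 ^ (g₁ + j * g)` bits, which is `8 * u` for
  -- `u = 2 ^ g₂ * 2 ^ (j * g)`; one more doubling adds the right half.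
  g₁ g : ℕ
  g₁ = 3 + g₂
  g  = suc g₁

  value : ℕ → ℕ → ℕ
  value j a = M * j * 2 ^ a

  -- The hits pay for the stale probes of all levels together. Each level also leaves a penalty of 4
  -- times the cost, for sub-blocks that exceed their budget of probes.
  price : ℕ → ℕ → ℕ → Cfg → List (Fin s) → Tree Round a → ℕ
  price j p e c S ω = 64 * M * hits c S (ops p e ω) + 4 * j * runCost c (ops p e ω)

  Bound : ℕ → ℕ → Set
  Bound j a = ∀ {p e c} → p < e → N ≡ 2 ^ a * e → Free c p e a →
              ∑[ ω ← Ω a ] value j a ≤ ∑[ ω ← Ω a ] price j p e c [] ω

  child< : ∀ {p e} → p < e → p + e < 2 * e
  child< {p} {e} p<e = subst (p + e <_) (cong (e +_) (sym (+-identityʳ e))) (+-monoˡ-< e p<e)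

  child≡ : ∀ {e} a → N ≡ 2 ^ suc a * e → N ≡ 2 ^ a * (2 * e)
  child≡ {e} a N≡ = trans N≡ (lemma (2 ^ a) e)
    where
    lemma : ∀ t e → 2 * t * e ≡ t * (2 * e)
    lemma = solve-∀

  price-node : ∀ j p e c S (l r : Tree Round a) →
    price j p e c S (node l r) ≡
    price j (p + e) (2 * e) c S l +
    price j p (2 * e) (run c (ops (p + e) (2 * e) l)) (history c S (ops (p + e) (2 * e) l)) r
  price-node j p e c S l r
    rewrite hits-++ c S (ops (p + e) (2 * e) l) (ops p (2 * e) r)
          | runCost-++ c (ops (p + e) (2 * e) l) (ops p (2 * e) r) =
    lemma (64 * M) (4 * j) (hits c S (ops (p + e) (2 * e) l)) _ (runCost c (ops (p + e) (2 * e) l)) _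
    where
    lemma : ∀ k k′ h h′ c c′ → k * (h + h′) + k′ * (c + c′) ≡ k * h + k′ * c + (k * h′ + k′ * c′)
    lemma = solve-∀

  price-monoˢ : ∀ j p e c S (ω : Tree Round a) → price j p e c [] ω ≤ price j p e c S ω
  price-monoˢ j p e c S ω =
    +-monoˡ-≤ (4 * j * runCost c (ops p e ω)) (*-monoʳ-≤ (64 * M) (hits-mono c [] S (ops p e ω)))

  price-monoʲ : ∀ j p e c S (ω : Tree Round a) → price j p e c S ω ≤ price (suc j) p e c S ω
  price-monoʲ j p e c S ω =
    +-monoʳ-≤ (64 * M * hits c S (ops p e ω))
              (*-monoˡ-≤ (runCost c (ops p e ω)) (*-monoʳ-≤ 4 (n≤1+n j)))

  Bound-zero : ∀ a → Bound 0 a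
  Bound-zero a p<e N≡ free = ∑-mono (Ω a) λ ω →
    ≤-trans (≤-reflexive (cong (_* 2 ^ a) (*-zeroʳ M))) z≤n

  -- Both halves satisfy `Bound j` with empty history; granting the right half the history of the
  -- left one only adds hits.
  Bound-suc : ∀ {j} a → Bound j a → Bound j (suc a)
  Bound-suc {j} a bound {p} {e} {c} p<e N≡ free = begin
    ∑[ ω ← Ω (suc a) ] value j (suc a)
      ≡⟨ ∑-product node (Ω a) (Ω a) _ ⟩
    ∑[ l ← Ω a ] (∑[ r ← Ω a ] value j (suc a))
      ≡⟨ (∑-cong (Ω a) λ l → ∑-cong (Ω a) λ r → lemma M j (2 ^ a)) ⟩
    ∑[ l ← Ω a ] (∑[ r ← Ω a ] (value j a + value j a))
      ≤⟨ ∑∑-+-mono (Ω a) (Ω a) _ _ _ _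
           (bound (child< p<e) (child≡ a N≡) (Free-left a free))
           (∑-mono (Ω a) λ l → ≤-trans
             (bound (<-≤-trans p<e (m≤m+n e _)) (child≡ a N≡) (Free-after-left (≤-<-trans z≤n p<e) l free))
             (∑-mono (Ω a) λ r → price-monoˢ j p (2 * e) _ (history c [] (ops (p + e) (2 * e) l)) r)) ⟩
    ∑[ l ← Ω a ] (∑[ r ← Ω a ] (price j (p + e) (2 * e) c [] l +
      price j p (2 * e) (run c (ops (p + e) (2 * e) l)) (history c [] (ops (p + e) (2 * e) l)) r))
      ≡⟨ (∑-cong (Ω a) λ l → ∑-cong (Ω a) λ r → price-node j p e c [] l r) ⟨
    ∑[ l ← Ω a ] (∑[ r ← Ω a ] price j p e c [] (node l r))
      ≡⟨ ∑-product node (Ω a) (Ω a) _ ⟨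
    ∑[ ω ← Ω (suc a) ] price j p e c [] ω ∎
    where
    open ≤-Reasoning
    lemma : ∀ M j t → M * j * (2 * t) ≡ M * j * t + M * j * t
    lemma = solve-∀

  cutsFrom-ops : ∀ q p e (t : Tree Bool a) κ → cutsFrom q (ops p e (zipTree t κ)) ≡ cuts (q ≤ᵇ_) p e t
  cutsFrom-ops q p e (leaf β)   (leaf _)     = +-identityʳ _
  cutsFrom-ops q p e (node l r) (node l′ r′) =
    trans (cutsFrom-++ q (ops (p + e) (2 * e) (zipTree l l′)) _)
          (cong₂ _+_ (cutsFrom-ops q (p + e) (2 * e) l l′) (cutsFrom-ops q p (2 * e) r r′))

  module Step (j : ℕ) (bound : Bound j (j * g)) {p e : ℕ} (p<e : p < e)
              (N≡ : N ≡ 2 ^ (g + j * g) * e) where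

    t b : ℕ
    t = 2 ^ (j * g)
    b = g₁ + j * g

    open Transfer {p} {e} {2 ^ g₂ * t} {M * t} {b} p<e
      (trans (child≡ b N≡) (cong (_* (2 * e)) (sym (leaves≡2^ b))))
      (trans (leaves≡2^ b) (trans (^-distribˡ-+-* 2 3 (g₂ + j * g)) (cong (8 *_) (^-distribˡ-+-* 2 g₂ (j * g)))))
      (few (j * g)) public

    module Sub (F : Family (Tree Bool b) δ) {p′ e′ : ℕ} (p′<e′ : p′ < e′) (N≡′ : N ≡ t * e′)
               (free : ∀ y → Free (C F y) p′ e′ (j * g)) where

      S : (Tree Round (j * g) → Tree Bool b → ℕ) → ℕ
      S f = ∑[ ω ← Ω (j * g) ] ∑ Ys (f ω)

      S-+ : ∀ f f′ → S (λ ω y → f ω y + f′ ω y) ≡ S f + S f′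
      S-+ f f′ = trans (∑-cong (Ω (j * g)) λ ω → ∑-+ Ys (f ω) (f′ ω)) (∑-+ (Ω (j * g)) _ _)

      S-* : ∀ k f → S (λ ω y → k * f ω y) ≡ k * S f
      S-* k f = trans (∑-cong (Ω (j * g)) λ ω → ∑-* Ys k (f ω)) (∑-* (Ω (j * g)) k _)

      S-cong : ∀ {f f′} → (∀ ω y → f ω y ≡ f′ ω y) → S f ≡ S f′
      S-cong f≡f′ = ∑-cong (Ω (j * g)) λ ω → ∑-cong Ys (f≡f′ ω)

      h₀ h₁ c₁ : Tree Round (j * g) → Tree Bool b → ℕ
      h₀ ω y = hits (C F y) [] (ops p′ e′ ω)
      h₁ ω y = hits (C F y) (R F y ++ H F y) (ops p′ e′ ω)
      c₁ ω y = runCost (C F y) (ops p′ e′ ω)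

      -- `forget` makes the sub-block start with empty recent history, so `h₁` exceeds `h₀` by just
      -- the stale probes. The budget is `M * t` for `t` rounds, and a common factor `t` cancels.
      between : S (λ ω y → M * t + 32 * M * h₀ ω y) ≤ S (λ ω y → 32 * M * h₁ ω y + 2 * c₁ ω y)
      between = *-cancelˡ-≤ t {{m^n≢0 2 (j * g)}} (begin
        t * S (λ ω y → M * t + 32 * M * h₀ ω y)
          ≡⟨ S-* t _ ⟨
        S (λ ω y → t * (M * t + 32 * M * h₀ ω y))
          ≡⟨ S-cong (λ ω y → lemma₁ M t (h₀ ω y)) ⟩
        S (λ ω y → gain (forget F) p′ e′ (j * g) ω y)
          ≤⟨ transfer (j * g) (forget F) p′ e′ (≤-<-trans z≤n p′<e′) free ⟩
        S (λ ω y → spent (forget F) p′ e′ (j * g) ω y)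
          ≡⟨ S-cong (λ ω y → lemma₂ M t (h₁ ω y) (c₁ ω y)) ⟩
        S (λ ω y → t * (32 * M * h₁ ω y + 2 * c₁ ω y))
          ≡⟨ S-* t _ ⟩
        t * S (λ ω y → 32 * M * h₁ ω y + 2 * c₁ ω y) ∎)
        where
        open ≤-Reasoning
        lemma₁ : ∀ M t h → t * (M * t + 32 * M * h) ≡ M * t * t + 32 * (M * t) * h
        lemma₁ = solve-∀
        lemma₂ : ∀ M t h c → 32 * (M * t) * h + 2 * (t * c) ≡ t * (32 * M * h + 2 * c)
        lemma₂ = solve-∀

      within : S (λ _ _ → value j (j * g)) ≤ S (λ ω y → price j p′ e′ (C F y) [] ω)
      within = begin
        S (λ _ _ → value j (j * g))
          ≡⟨ ∑-swap (Ω (j * g)) Ys _ ⟩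
        ∑[ y ← Ys ] (∑[ ω ← Ω (j * g) ] value j (j * g))
          ≤⟨ ∑-mono Ys (λ y → bound p′<e′ N≡′ (free y)) ⟩
        ∑[ y ← Ys ] (∑[ ω ← Ω (j * g) ] price j p′ e′ (C F y) [] ω)
          ≡⟨ ∑-swap Ys (Ω (j * g)) (λ y ω → price j p′ e′ (C F y) [] ω) ⟩
        S (λ ω y → price j p′ e′ (C F y) [] ω) ∎
        where open ≤-Reasoning

      -- Twice `between` plus the induction hypothesis `within`: the hits `h₀` inside the sub-block
      -- cancel, and two units are gained.
      sub-block : S (λ _ _ → value (2 + j) (j * g)) ≤
                  S (λ ω y → price (suc j) p′ e′ (C F y) (R F y ++ H F y) ω)
      sub-block = +-cancelʳ-≤ (S (λ ω y → 64 * M * h₀ ω y)) _ _ (begin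
        S (λ _ _ → value (2 + j) (j * g)) + S (λ ω y → 64 * M * h₀ ω y)
          ≡⟨ S-+ _ _ ⟨
        S (λ ω y → value (2 + j) (j * g) + 64 * M * h₀ ω y)
          ≡⟨ S-cong (λ ω y → lemma₁ M j t (h₀ ω y)) ⟩
        S (λ ω y → 2 * (M * t + 32 * M * h₀ ω y) + value j (j * g))
          ≡⟨ trans (S-+ _ _) (cong (_+ S (λ _ _ → value j (j * g))) (S-* 2 _)) ⟩
        2 * S (λ ω y → M * t + 32 * M * h₀ ω y) + S (λ _ _ → value j (j * g))
          ≤⟨ +-mono-≤ (*-monoʳ-≤ 2 between) within ⟩
        2 * S (λ ω y → 32 * M * h₁ ω y + 2 * c₁ ω y) + S (λ ω y → price j p′ e′ (C F y) [] ω)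
          ≡⟨ trans (S-+ _ _) (cong (_+ S (λ ω y → price j p′ e′ (C F y) [] ω)) (S-* 2 _)) ⟨
        S (λ ω y → 2 * (32 * M * h₁ ω y + 2 * c₁ ω y) + price j p′ e′ (C F y) [] ω)
          ≡⟨ S-cong (λ ω y → lemma₂ M j (h₀ ω y) (h₁ ω y) (c₁ ω y)) ⟩
        S (λ ω y → price (suc j) p′ e′ (C F y) (R F y ++ H F y) ω + 64 * M * h₀ ω y)
          ≡⟨ S-+ _ _ ⟩
        S (λ ω y → price (suc j) p′ e′ (C F y) (R F y ++ H F y) ω) + S (λ ω y → 64 * M * h₀ ω y) ∎)
        where
        open ≤-Reasoning
        lemma₁ : ∀ M j t h → M * (2 + j) * t + 64 * M * h ≡ 2 * (M * t + 32 * M * h) + M * j * t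
        lemma₁ = solve-∀
        lemma₂ : ∀ M j h h′ c → 2 * (32 * M * h′ + 2 * c) + (64 * M * h + 4 * j * c) ≡
                 64 * M * h′ + 4 * (1 + j) * c + 64 * M * h
        lemma₂ = solve-∀

    right-half : ∀ d (F : Family (Tree Bool b) δ) {p′ e′} → p′ < e′ → N ≡ 2 ^ (d + j * g) * e′ →
                 (∀ y → Free (C F y) p′ e′ (d + j * g)) →
                 ∑[ ω ← Ω (d + j * g) ] (∑[ y ← Ys ] value (2 + j) (d + j * g)) ≤
                 ∑[ ω ← Ω (d + j * g) ] (∑[ y ← Ys ] price (suc j) p′ e′ (C F y) (R F y ++ H F y) ω)
    right-half zero    F p′<e′ N≡′ free = Sub.sub-block F p′<e′ N≡′ free
    right-half (suc d) F {p′} {e′} p′<e′ N≡′ free = begin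
      ∑[ ω ← Ω (suc α) ] (∑[ y ← Ys ] value (2 + j) (suc α))
        ≡⟨ ∑-product node (Ω α) (Ω α) _ ⟩
      ∑[ l ← Ω α ] (∑[ r ← Ω α ] (∑[ y ← Ys ] value (2 + j) (suc α)))
        ≡⟨ (∑-cong (Ω α) λ l → ∑-cong (Ω α) λ r →
             trans (∑-cong Ys λ y → lemma M (2 + j) (2 ^ α)) (∑-+ Ys _ _)) ⟩
      ∑[ l ← Ω α ] (∑[ r ← Ω α ] ((∑[ y ← Ys ] value (2 + j) α) + (∑[ y ← Ys ] value (2 + j) α)))
        ≤⟨ ∑∑-+-mono (Ω α) (Ω α) _ _ _ _
             (right-half d F (child< p′<e′) (child≡ α N≡′) (λ y → Free-left α (free y)))
             (∑-mono (Ω α) λ l → right-half d (F₁ l) (<-≤-trans p′<e′ (m≤m+n e′ _)) (child≡ α N≡′)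
               (λ y → Free-after-left 0<e′ l (free y))) ⟩
      ∑[ l ← Ω α ] (∑[ r ← Ω α ]
        ((∑[ y ← Ys ] price (suc j) pˡ eˡ (C F y) (R F y ++ H F y) l) +
         (∑[ y ← Ys ] price (suc j) p′ eˡ (C (F₁ l) y) (R (F₁ l) y ++ H F y) r)))
        ≡⟨ (∑-cong (Ω α) λ l → ∑-cong (Ω α) λ r →
             trans (∑-cong Ys λ y → merge l r y) (∑-+ Ys _ _)) ⟨
      ∑[ l ← Ω α ] (∑[ r ← Ω α ] (∑[ y ← Ys ] price (suc j) p′ e′ (C F y) (R F y ++ H F y) (node l r)))
        ≡⟨ ∑-product node (Ω α) (Ω α) _ ⟨
      ∑[ ω ← Ω (suc α) ] (∑[ y ← Ys ] price (suc j) p′ e′ (C F y) (R F y ++ H F y) ω) ∎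
      where
      open ≤-Reasoning
      α  = d + j * g
      pˡ = p′ + e′
      eˡ = 2 * e′
      0<e′ : 0 < e′
      0<e′ = ≤-<-trans z≤n p′<e′
      F₁ : Tree Round α → Family (Tree Bool b) δ
      F₁ l = advance F (ops pˡ eˡ l) λ y → Admissible-ops (0<2* 0<e′) l (Free-left α (free y))
      lemma : ∀ M j t → M * j * (2 * t) ≡ M * j * t + M * j * t
      lemma = solve-∀
      merge : ∀ l r y → price (suc j) p′ e′ (C F y) (R F y ++ H F y) (node l r) ≡
              price (suc j) pˡ eˡ (C F y) (R F y ++ H F y) l +
              price (suc j) p′ eˡ (C (F₁ l) y) (R (F₁ l) y ++ H F y) r
      merge l r y = trans (price-node (suc j) p′ e′ (C F y) (R F y ++ H F y) l r)
        (cong (λ S → price (suc j) pˡ eˡ (C F y) (R F y ++ H F y) l + price (suc j) p′ eˡ (C (F₁ l) y) S r)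
              (history-++ˢ (C F y) (R F y) (H F y) (ops pˡ eˡ l)))

  -- The left half keeps `value j` and the right half reaches `value (2 + j)`; their average is the
  -- `suc j` that is wanted.
  Bound-step : ∀ j → (∀ d → Bound j (d + j * g)) → Bound (suc j) (suc j * g)
  Bound-step j bound {p} {e} {c} p<e N≡ free = begin
    ∑[ ω ← Ω (suc b) ] value (suc j) (suc b)
      ≡⟨ ∑-product node (Ω b) (Ω b) _ ⟩
    ∑[ l ← Ω b ] (∑[ r ← Ω b ] value (suc j) (suc b))
      ≡⟨ (∑-cong (Ω b) λ l → ∑-cong (Ω b) λ r → lemma M j (2 ^ b)) ⟩
    ∑[ l ← Ω b ] (∑[ r ← Ω b ] (value j b + value (2 + j) b))
      ≤⟨ ∑∑-+-mono (Ω b) (Ω b) _ _ _ _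
           (bound g₁ (child< p<e) (child≡ b N≡) (Free-left b free)) right ⟩
    ∑[ l ← Ω b ] (∑[ r ← Ω b ] (price j pˡ eˡ c [] l + price (suc j) p eˡ (C₁ l) (S₁ l) r))
      ≤⟨ (∑-mono (Ω b) λ l → ∑-mono (Ω b) λ r →
           +-monoˡ-≤ (price (suc j) p eˡ (C₁ l) (S₁ l) r) (price-monoʲ j pˡ eˡ c [] l)) ⟩
    ∑[ l ← Ω b ] (∑[ r ← Ω b ] (price (suc j) pˡ eˡ c [] l + price (suc j) p eˡ (C₁ l) (S₁ l) r))
      ≡⟨ (∑-cong (Ω b) λ l → ∑-cong (Ω b) λ r → price-node (suc j) p e c [] l r) ⟨
    ∑[ l ← Ω b ] (∑[ r ← Ω b ] price (suc j) p e c [] (node l r))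
      ≡⟨ ∑-product node (Ω b) (Ω b) _ ⟨
    ∑[ ω ← Ω (suc b) ] price (suc j) p e c [] ω ∎
    where
    open ≤-Reasoning
    open Step j (bound 0) p<e N≡
    b′ = b
    pˡ = p + e
    eˡ = 2 * e
    C₁ : Tree Round b → Cfg
    C₁ l = run c (ops pˡ eˡ l)
    S₁ : Tree Round b → List (Fin s)
    S₁ l = history c [] (ops pˡ eˡ l)
    lemma : ∀ M j t → M * (1 + j) * (2 * t) ≡ M * j * t + M * (2 + j) * t
    lemma = solve-∀
    0<e : 0 < e
    0<e = ≤-<-trans z≤n p<e
    -- Memory and answers from the start of the block are independent of the bits `y`, so they serve
    -- as `original` and `κ`; the probes of the left half are all old.
    family : Tree ℕ b → Family (Tree Bool b) (λ q → cuts (q ≤ᵇ_) pˡ eˡ)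
    family κ = record
      { C         = λ y → C₁ (zipTree y κ)
      ; R         = λ _ → []
      ; H         = λ y → S₁ (zipTree y κ)
      ; original  = cell c
      ; untouched = λ y x∉ → sym (run-frame c [] (ops pˡ eˡ (zipTree y κ)) x∉)
      ; κ         = response c
      ; answers   = λ y q q<N → trans
          (cong (response (C₁ (zipTree y κ)) q +_) (sym (cutsFrom-ops q pˡ eˡ y κ)))
          (response-run c (ops pˡ eˡ (zipTree y κ))
            (Admissible-ops (0<2* 0<e) (zipTree y κ) (Free-left b free)) q<N)
      }
    -- Only the bits of the left half matter; its queries κ are fixed.
    right : ∑[ l ← Ω b ] (∑[ r ← Ω b ] value (2 + j) b) ≤
            ∑[ l ← Ω b ] (∑[ r ← Ω b ] price (suc j) p eˡ (C₁ l) (S₁ l) r)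
    right = begin
      ∑[ l ← Ω b ] (∑[ r ← Ω b ] value (2 + j) b)
        ≡⟨ trans (∑-zipTree bools (upTo N) b _) (∑-cong (trees (upTo N) b) λ κ → ∑-swap Ys (Ω b) λ _ _ → value (2 + j) b) ⟩
      ∑[ κ ← trees (upTo N) b ] (∑[ r ← Ω b ] (∑[ y ← Ys ] value (2 + j) b))
        ≤⟨ (∑-mono (trees (upTo N) b) λ κ → right-half g₁ (family κ)
             (<-≤-trans p<e (m≤m+n e _)) (child≡ b N≡)
             (λ y → Free-after-left 0<e (zipTree y κ) free)) ⟩
      ∑[ κ ← trees (upTo N) b ] (∑[ r ← Ω b ] (∑[ y ← Ys ] price (suc j) p eˡ (C₁ (zipTree y κ)) (S₁ (zipTree y κ)) r))
        ≡⟨ trans (∑-zipTree bools (upTo N) b _) (∑-cong (trees (upTo N) b) λ κ →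
             ∑-swap Ys (Ω b) λ y r → price (suc j) p eˡ (C₁ (zipTree y κ)) (S₁ (zipTree y κ)) r) ⟨
      ∑[ l ← Ω b ] (∑[ r ← Ω b ] price (suc j) p eˡ (C₁ l) (S₁ l) r) ∎

  bounds : ∀ j d → Bound j (d + j * g)
  bounds j       (suc d) = Bound-suc (d + j * g) (bounds j d)
  bounds zero    zero    = Bound-zero 0
  bounds (suc j) zero    = Bound-step j (bounds j)

  -- Hits are at most the cost, and `j ≤ M` absorbs the penalties: 68 is 64 + 4.
  expensive : ∀ j d {c} → 0 < M → j ≤ M → N ≡ 2 ^ (d + j * g) → Free c 0 1 (d + j * g) →
              ∃[ ω ] j * N ≤ 68 * runCost c (ops {d + j * g} 0 1 ω)
  expensive j d {c} 0<M j≤M N≡ free = ∑-average (Ω α) _ (j * N) nonempty (*-cancelˡ-≤ M {{>-nonZero 0<M}} (begin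
    M * (length (Ω α) * (j * N))
      ≡⟨ trans (lemma₁ M (length (Ω α)) j N) (cong (λ k → length (Ω α) * (M * j * k)) N≡) ⟩
    length (Ω α) * value j α
      ≡⟨ ∑-const (Ω α) (value j α) ⟨
    ∑[ ω ← Ω α ] value j α
      ≤⟨ bounds j d z<s (trans N≡ (sym (*-identityʳ _))) free ⟩
    ∑[ ω ← Ω α ] price j 0 1 c [] ω
      ≤⟨ ∑-mono (Ω α) cheap ⟩
    ∑[ ω ← Ω α ] M * (68 * runCost c (ops 0 1 ω))
      ≡⟨ ∑-* (Ω α) M _ ⟩
    M * (∑[ ω ← Ω α ] 68 * runCost c (ops 0 1 ω)) ∎))
    where
    open ≤-Reasoning
    α = d + j * g
    lemma₁ : ∀ M l j n → M * (l * (j * n)) ≡ l * (M * j * n)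
    lemma₁ = solve-∀
    lemma₂ : ∀ M k → 64 * M * k + 4 * M * k ≡ M * (68 * k)
    lemma₂ = solve-∀
    cheap : ∀ ω → price j 0 1 c [] ω ≤ M * (68 * runCost c (ops 0 1 ω))
    cheap ω = ≤-trans
      (+-mono-≤ (*-monoʳ-≤ (64 * M) (hits≤runCost c [] (ops 0 1 ω)))
                (*-monoˡ-≤ (runCost c (ops 0 1 ω)) (*-monoʳ-≤ 4 j≤M)))
      (≤-reflexive (lemma₂ M (runCost c (ops 0 1 ω))))
    nonempty : 0 < length (Ω α)
    nonempty = subst (0 <_) (sym (length-trees rounds α))
      (m>0⇒m^n>0 (leaves α) (subst (0 <_) (sym (length-product _,_ bools (upTo N)))
        (*-mono-< {0} {2} z<s (subst (0 <_) (sym (length-upTo N)) (subst (0 <_) (sym N≡) (m^n>0 2 α))))))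
      where
      m>0⇒m^n>0 : ∀ {m} n → 0 < m → 0 < m ^ n
      m>0⇒m^n>0 {suc m} n _ = m^n>0 (suc m) n

-- Probes and simulation on the Word RAM.

open State

-- Registers and memories are functions, so the true and the simulated run are compared value by
-- value.
updateAt-pointwise : ∀ {xs ys : Vector X n} {x y} i j → x ≡ y → xs j ≡ ys j →
                     updateAt xs i (const x) j ≡ updateAt ys i (const y) j
updateAt-pointwise Fin.zero    Fin.zero    x≡y _  = x≡y
updateAt-pointwise Fin.zero    (Fin.suc j) _   p≡ = p≡
updateAt-pointwise (Fin.suc i) Fin.zero    _   p≡ = p≡
updateAt-pointwise {n = suc (suc n)} (Fin.suc i) (Fin.suc j) x≡y p≡ = updateAt-pointwise i j x≡y p≡

funToFin-cong : ∀ {m n} {f g : Fin m → Fin n} → (∀ i → f i ≡ g i) → funToFin f ≡ funToFin g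
funToFin-cong {zero}  f≡g = refl
funToFin-cong {suc m} f≡g = cong₂ combine (f≡g Fin.zero) (funToFin-cong (f≡g ∘ Fin.suc))

-- Correctness promises a run for each whole sequence of operations. Determinism makes sequences
-- with the same first operation share the state after it, so later operations can be chosen
-- afterwards.
Exec-unique : ∀ {w r} {P : Program r} {c : ℕ × State w r} {t t′ s s′} →
              Exec P c t s → Exec P c t′ s′ → s ≡ s′
Exec-unique (halt _)   (halt _)    = refl
Exec-unique (halt f≡)  (next f≡′ _) = contradiction (trans (sym f≡) f≡′) λ ()
Exec-unique (next f≡ _) (halt f≡′)  = contradiction (trans (sym f≡) f≡′) λ ()
Exec-unique (next f≡ E) (next f≡′ E′) with trans (sym f≡) f≡′
... | refl = Exec-unique E E′

module _ {w r : ℕ} where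

  -- Overwriting counts as probing, so that cells outside the trace keep their contents.
  probed : Instruction r → State w r → List (Word w)
  probed (load d addr)  s = [ registers s addr ]
  probed (store addr x) s = [ registers s addr ]
  probed (set d c)      s = []
  probed (op f d x y)   s = []
  probed (ifZero x l)   s = []

  length-probed : ∀ i s → length (probed i s) ≤ 1
  length-probed (load d addr)  s = ≤-refl
  length-probed (store addr x) s = ≤-refl
  length-probed (set d c)      s = z≤n
  length-probed (op f d x y)   s = z≤n
  length-probed (ifZero x l)   s = z≤n

  step-frame : ∀ i pc (s : State w r) x → x ∉ probed i s →
               memory (proj₂ (step i (pc , s))) x ≡ memory s x
  step-frame (load d addr)  pc s x x∉ = refl
  step-frame (store addr y) pc s x x∉ =
    updateAt-minimal x (registers s addr) (memory s) λ x≡ → x∉ (here x≡)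
  step-frame (set d c)      pc s x x∉ = refl
  step-frame (op f d y z)   pc s x x∉ = refl
  step-frame (ifZero y l)   pc s x x∉ = refl

  probes : ∀ {P : Program r} {c : ℕ × State w r} {t s′} → Exec P c t s′ → List (Word w)
  probes (halt _)                = []
  probes (next {s = s} {i} _ E) = probed i s ++ probes E

  length-probes : ∀ {P : Program r} {c t s′} (E : Exec {w} P c t s′) → length (probes E) ≤ t
  length-probes (halt _) = z≤n
  length-probes (next {s = s} {i} _ E) =
    ≤-trans (≤-reflexive (length-++ (probed i s))) (+-mono-≤ (length-probed i s) (length-probes E))

  probes-frame : ∀ {P : Program r} {pc s t s′} (E : Exec {w} P (pc , s) t s′) {x} →
                 x ∉ probes E → memory s′ x ≡ memory s x
  probes-frame (halt _) x∉ = refl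
  probes-frame (next {pc} {s} {i} _ E) {x} x∉ =
    trans (probes-frame E (x∉ ∘ ∈-++⁺ʳ (probed i s))) (step-frame i pc s x (x∉ ∘ ∈-++⁺ˡ))

  record Similar (i : Instruction r) (pc : ℕ) (s σ : State w r) : Set where
    field
      counter : proj₁ (step i (pc , s)) ≡ proj₁ (step i (pc , σ))
      regs    : ∀ j → registers (proj₂ (step i (pc , s))) j ≡ registers (proj₂ (step i (pc , σ))) j
      mem     : ∀ x → memory s x ≡ memory σ x →
                memory (proj₂ (step i (pc , s))) x ≡ memory (proj₂ (step i (pc , σ))) x

  open Similar

  step-similar : ∀ i pc s σ → (∀ j → registers s j ≡ registers σ j) →
                 (∀ {x} → x ∈ probed i s → memory s x ≡ memory σ x) → Similar i pc s σ
  step-similar (set d c) pc s σ R≡ M≡ = record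
    { counter = refl
    ; regs    = λ j → updateAt-pointwise d j refl (R≡ j)
    ; mem     = λ _ M≡ → M≡
    }
  step-similar (op f d x y) pc s σ R≡ M≡ = record
    { counter = refl
    ; regs    = λ j → updateAt-pointwise d j (cong₂ (⟦ f ⟧ w) (R≡ x) (R≡ y)) (R≡ j)
    ; mem     = λ _ M≡ → M≡
    }
  step-similar (load d addr) pc s σ R≡ M≡ = record
    { counter = refl
    ; regs    = λ j → updateAt-pointwise d j
                  (trans (M≡ (here refl)) (cong (memory σ) (R≡ addr))) (R≡ j)
    ; mem     = λ _ M≡ → M≡
    }
  step-similar (store addr y) pc s σ R≡ M≡ = record
    { counter = refl
    ; regs    = R≡
    ; mem     = λ x M≡ → trans
        (updateAt-pointwise (registers s addr) x (R≡ y) M≡)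
        (cong (λ a → updateAt (memory σ) a (const (registers σ y)) x) (R≡ addr))
    }
  step-similar (ifZero x l) pc s σ R≡ M≡ = record
    { counter = cong (λ v → if toℕ v ≡ᵇ 0 then l else suc pc) (R≡ x)
    ; regs    = R≡
    ; mem     = λ _ M≡ → M≡
    }

  execute : ℕ → Program r → ℕ × State w r → State w r
  execute zero       P (pc , s) = s
  execute (suc fuel) P (pc , s) with fetch P pc
  ... | nothing = s
  ... | just i  = execute fuel P (step i (pc , s))

  -- The true run reads memory only at the cells in `probes E`, and a step preserves agreement at
  -- every cell; so `σ` may be wrong elsewhere.
  execute-correct : ∀ {P : Program r} {pc s t s′} (E : Exec {w} P (pc , s) t s′) fuel {σ} → t ≤ fuel →
                    (∀ j → registers s j ≡ registers σ j) →
                    (∀ {x} → x ∈ probes E → memory s x ≡ memory σ x) →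
                    ∀ j → registers s′ j ≡ registers (execute fuel P (pc , σ)) j
  execute-correct (halt f≡) zero       _ R≡ M≡ = R≡
  execute-correct (halt f≡) (suc fuel) _ R≡ M≡ rewrite f≡ = R≡
  execute-correct {P} (next {pc} {s} {i} f≡ E) (suc fuel) {σ} (s≤s t≤) R≡ M≡ j rewrite f≡ =
    trans (execute-correct E fuel t≤ (regs similar) later j)
          (cong (λ pc′ → registers (execute fuel P (pc′ , proj₂ (step i (pc , σ)))) j) (counter similar))
    where
    similar : Similar i pc s σ
    similar = step-similar i pc s σ R≡ (M≡ ∘ ∈-++⁺ˡ)
    later : ∀ {x} → x ∈ probes E → memory (proj₂ (step i (pc , s))) x ≡ memory (proj₂ (step i (pc , σ))) x
    later {x} x∈ = mem similar x (M≡ (∈-++⁺ʳ (probed i s) x∈))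

-- Subtree sizes in a caterpillar.

open Forest

count-∷ : ∀ {P : X → Set} (P? : ∀ x → Dec (P x)) x (xs : Vec X n) →
          count P? (x ∷ xs) ≡ bit (does (P? x)) + count P? xs
count-∷ P? x xs with does (P? x)
... | true  = refl
... | false = refl

count-cong : ∀ {P Q : X → Set} (P? : ∀ x → Dec (P x)) (Q? : ∀ x → Dec (Q x)) (f : Fin n → X) →
             (∀ i → does (P? (f i)) ≡ does (Q? (f i))) →
             count P? (tabulate f) ≡ count Q? (tabulate f)
count-cong {n = zero}  P? Q? f P≡Q = refl
count-cong {n = suc n} P? Q? f P≡Q
  rewrite count-∷ P? (f Fin.zero) (tabulate (f ∘ Fin.suc))
        | count-∷ Q? (f Fin.zero) (tabulate (f ∘ Fin.suc)) =
  cong₂ _+_ (cong bit (P≡Q Fin.zero)) (count-cong P? Q? (f ∘ Fin.suc) (P≡Q ∘ Fin.suc))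

count-remove : ∀ {P Q : X → Set} (P? : ∀ x → Dec (P x)) (Q? : ∀ x → Dec (Q x)) (f : Fin n → X) l →
               (∀ i → i ≢ l → does (P? (f i)) ≡ does (Q? (f i))) → does (P? (f l)) ≡ false →
               count P? (tabulate f) + bit (does (Q? (f l))) ≡ count Q? (tabulate f)
count-remove P? Q? f Fin.zero P≡Q ¬P
  rewrite count-∷ P? (f Fin.zero) (tabulate (f ∘ Fin.suc))
        | count-∷ Q? (f Fin.zero) (tabulate (f ∘ Fin.suc)) | ¬P =
  trans (+-comm (count P? (tabulate (f ∘ Fin.suc))) _)
        (cong (bit (does (Q? (f Fin.zero))) +_)
              (count-cong P? Q? (f ∘ Fin.suc) λ i → P≡Q (Fin.suc i) λ ()))
count-remove P? Q? f (Fin.suc l) P≡Q ¬P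
  rewrite count-∷ P? (f Fin.zero) (tabulate (f ∘ Fin.suc))
        | count-∷ Q? (f Fin.zero) (tabulate (f ∘ Fin.suc)) =
  trans (+-assoc (bit (does (P? (f Fin.zero)))) _ _)
        (cong₂ _+_ (cong bit (P≡Q Fin.zero λ ()))
          (count-remove P? Q? (f ∘ Fin.suc) l (λ i i≢l → P≡Q (Fin.suc i) λ { refl → i≢l refl }) ¬P))

module _ {n} (F : Forest n) (l : Fin n) where

  cutEdge-at : parent (cutEdge F l) l ≡ nothing
  cutEdge-at = updateAt-updates l (parent F)

  cutEdge-off : ∀ {u} → u ≢ l → parent (cutEdge F l) u ≡ parent F u
  cutEdge-off {u} u≢l = updateAt-minimal u l (parent F) u≢l

  cutEdge-⊆ : ∀ {u v} → parent (cutEdge F l) u ≡ just v → parent F u ≡ just v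
  cutEdge-⊆ {u} p≡ with u ≟ l
  ... | yes refl = contradiction (trans (sym cutEdge-at) p≡) λ ()
  ... | no  u≢l  = trans (sym (cutEdge-off u≢l)) p≡

  -- A path to `v` can pass through a childless `l` only by starting there, so no other vertex gains
  -- or loses `v` as an ancestor.
  subtreeSize-cutEdge : ∀ {v} → (∀ u → parent F u ≢ just l) → l ≢ v →
    subtreeSize (cutEdge F l) v + bit (does (descendantOf? F v l)) ≡ subtreeSize F v
  subtreeSize-cutEdge {v} childless l≢v =
    count-remove (descendantOf? (cutEdge F l) v) (descendantOf? F v) id l
      (λ u u≢l → does-⇔ (mk⇔ old (new u≢l)) (descendantOf? (cutEdge F l) v u) (descendantOf? F v u))
      (dec-false (descendantOf? (cutEdge F l) v l) detached)
    where
    old : ∀ {u} → DescendantOf (cutEdge F l) u v → DescendantOf F u v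
    old ε        = ε
    old (p≡ ◅ d) = cutEdge-⊆ p≡ ◅ old d
    new : ∀ {u} → u ≢ l → DescendantOf F u v → DescendantOf (cutEdge F l) u v
    new u≢l ε            = ε
    new {u} u≢l (p≡ ◅ d) = trans (cutEdge-off u≢l) p≡ ◅ new (λ { refl → childless u p≡ }) d
    detached : ¬ DescendantOf (cutEdge F l) l v
    detached ε        = l≢v refl
    detached (p≡ ◅ _) = contradiction (trans (sym cutEdge-at) p≡) λ ()

-- The caterpillar: a path of N vertices, numbered from its root, with a leaf
-- N + p attached to each vertex p.
module Caterpillar {N n : ℕ} (0<N : 0 < N) (2N≤n : N + N ≤ n) where

  instance
    n≢0 : NonZero n
    n≢0 = >-nonZero (≤-trans 0<N (≤-trans (m≤m+n N N) 2N≤n))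

  vertex spine pendant : ℕ → Fin n
  vertex x  = x mod n
  spine     = vertex
  pendant p = vertex (N + p)

  toℕ-vertex : ∀ {x} → x < n → toℕ (vertex x) ≡ x
  toℕ-vertex {x} x<n = trans (toℕ-fromℕ< (m%n<n x n)) (m<n⇒m%n≡m x<n)

  toℕ-vertex≤ : ∀ x → toℕ (vertex x) ≤ x
  toℕ-vertex≤ x = ≤-trans (≤-reflexive (toℕ-fromℕ< (m%n<n x n))) (m%n≤m x n)

  toℕ-spine : ∀ {p} → p < N → toℕ (spine p) ≡ p
  toℕ-spine p<N = toℕ-vertex (<-≤-trans p<N (≤-trans (m≤m+n N N) 2N≤n))

  toℕ-pendant : ∀ {p} → p < N → toℕ (pendant p) ≡ N + p
  toℕ-pendant p<N = toℕ-vertex (<-≤-trans (+-monoʳ-< N p<N) 2N≤n)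

  pendant-injective : ∀ {p p′} → p < N → p′ < N → pendant p ≡ pendant p′ → p ≡ p′
  pendant-injective p<N p′<N p≡ = +-cancelˡ-≡ N _ _
    (trans (sym (toℕ-pendant p<N)) (trans (cong toℕ p≡) (toℕ-pendant p′<N)))

  -- The last case leaves all vertices beyond the caterpillar as isolated roots.
  up : ℕ → Maybe ℕ
  up zero = nothing
  up (suc x) with suc x <? N | suc x <? N + N
  ... | yes _ | _     = just x
  ... | no  _ | yes _ = just (suc x ∸ N)
  ... | no  _ | no  _ = nothing

  up-< : ∀ {x y} → up x ≡ just y → y < x × y < N
  up-< {suc x} p≡ with suc x <? N | suc x <? N + N
  up-< {suc x} refl | yes sx<N | _      = ≤-refl , <-trans (n<1+n x) sx<N
  up-< {suc x} refl | no  sx≮N | yes sx< =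
    m>n⇒m∸n<m (≮⇒≥ sx≮N) , +-cancelʳ-< N _ _ (subst (_< N + N) (sym (m∸n+n≡m (≮⇒≥ sx≮N))) sx<)
    where
    m>n⇒m∸n<m : ∀ {m} → N ≤ m → m ∸ N < m
    m>n⇒m∸n<m {m} N≤m = ∸-monoʳ-< {m} 0<N N≤m

  up-spine : ∀ {x} → suc x < N → up (suc x) ≡ just x
  up-spine {x} sx<N with suc x <? N | suc x <? N + N
  ... | yes _    | _ = refl
  ... | no  sx≮N | _ = contradiction sx<N sx≮N

  up-pendant : ∀ {p} → p < N → up (N + p) ≡ just p
  up-pendant {p} p<N = go (N + p) refl
    where
    go : ∀ x → x ≡ N + p → up x ≡ just p
    go zero    x≡ = contradiction (subst (0 <_) (sym x≡) (≤-trans 0<N (m≤m+n N p))) λ ()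
    go (suc x) x≡ with suc x <? N | suc x <? N + N
    ... | yes sx<N | _      = contradiction (subst (_< N) x≡ sx<N) (m+n≮m N p)
    ... | no  _    | yes _  = cong just (trans (cong (_∸ N) x≡) (m+n∸m≡n N p))
    ... | no  _    | no sx≮ = contradiction (subst (_< N + N) (sym x≡) (+-monoʳ-< N p<N)) sx≮

  parent₀ : Vector (Maybe (Fin n)) n
  parent₀ u = Maybe.map vertex (up (toℕ u))

  parent₀-< : ∀ {u v} → parent₀ u ≡ just v → toℕ v < toℕ u × toℕ v < N
  parent₀-< {u} p≡ with up (toℕ u) in up≡
  parent₀-< {u} refl | just y =
    ≤-<-trans (toℕ-vertex≤ y) (proj₁ (up-< {toℕ u} up≡)) , ≤-<-trans (toℕ-vertex≤ y) (proj₂ (up-< {toℕ u} up≡))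

  caterpillar : Forest n
  caterpillar = record
    { parent  = parent₀
    ; acyclic = Subrelation.wellFounded (λ p≡ → proj₁ (parent₀-< p≡)) (On.wellFounded toℕ <-wellFounded)
    }

  -- What survives the cutting of leaves. By `inner`, pendants have no children and numbers never
  -- decrease from a vertex to its descendants; whether a particular leaf is still attached is
  -- tracked by `Attached`.
  record Shape (F : Forest n) : Set where
    field
      path  : ∀ {x} → suc x < N → parent F (spine (suc x)) ≡ just (spine x)
      inner : ∀ {u v} → parent F u ≡ just v → toℕ v < toℕ u × toℕ v < N

  open Shape

  caterpillar-shape : Shape caterpillar
  caterpillar-shape = record
    { path  = λ {x} sx<N → cong (Maybe.map vertex) (trans (cong up (toℕ-spine sx<N)) (up-spine sx<N))
    ; inner = parent₀-<
    }

  caterpillar-pendant : ∀ {p} → p < N → parent caterpillar (pendant p) ≡ just (spine p)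
  caterpillar-pendant p<N = cong (Maybe.map vertex) (trans (cong up (toℕ-pendant p<N)) (up-pendant p<N))

  spine≢pendant : ∀ {x p} → x < N → p < N → spine x ≢ pendant p
  spine≢pendant {x} {p} x<N p<N s≡ = m+n≮m N p
    (subst (_< N) (trans (sym (toℕ-spine x<N)) (trans (cong toℕ s≡) (toℕ-pendant p<N))) x<N)

  module _ {F : Forest n} (shape : Shape F) {p : ℕ} (p<N : p < N) where

    cut-shape : Shape (cutEdge F (pendant p))
    cut-shape = record
      { path  = λ sx<N → trans (cutEdge-off F (pendant p) (spine≢pendant sx<N p<N)) (path shape sx<N)
      ; inner = λ p≡ → inner shape (cutEdge-⊆ F (pendant p) p≡)
      }

    pendant-childless : ∀ u → parent F u ≢ just (pendant p)
    pendant-childless u p≡ = m+n≮m N p (subst (_< N) (toℕ-pendant p<N) (proj₂ (inner shape p≡)))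

    module _ (attached : parent F (pendant p) ≡ just (spine p)) {q : ℕ} (q<N : q < N) where

      along : ∀ {x} → x < N → q ≤ x → DescendantOf F (spine x) (spine q)
      along {zero}  _    z≤n = ε
      along {suc x} sx<N q≤ with m≤n⇒m<n∨m≡n q≤
      ... | inj₁ (s≤s q≤x) = path shape sx<N ◅ along (<-trans (n<1+n x) sx<N) q≤x
      ... | inj₂ refl      = ε

      descendant-≤ : ∀ {u v} → DescendantOf F u v → toℕ v ≤ toℕ u
      descendant-≤ ε        = ≤-refl
      descendant-≤ (p≡ ◅ d) = ≤-trans (descendant-≤ d) (<⇒≤ (proj₁ (inner shape p≡)))

      below : DescendantOf F (pendant p) (spine q) → q ≤ p
      below d = go d refl
        where
        go : ∀ {u} → DescendantOf F u (spine q) → u ≡ pendant p → q ≤ p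
        go ε        s≡ = contradiction s≡ (spine≢pendant q<N p<N)
        go (p≡ ◅ d) refl with trans (sym attached) p≡
        ... | refl = subst₂ _≤_ (toℕ-spine q<N) (toℕ-spine p<N) (descendant-≤ d)

      subtreeSize-cut-pendant :
        subtreeSize (cutEdge F (pendant p)) (spine q) + bit (q ≤ᵇ p) ≡ subtreeSize F (spine q)
      subtreeSize-cut-pendant = trans
        (cong (λ b → subtreeSize (cutEdge F (pendant p)) (spine q) + bit b)
          (sym (does-⇔ (mk⇔ below (λ q≤p → attached ◅ along p<N q≤p))
                       (descendantOf? F (spine q) (pendant p)) (q ≤? p))))
        (subtreeSize-cutEdge F (pendant p) pendant-childless (≢-sym (spine≢pendant q<N p<N)))

-- A data structure as a probe machine.

module Concrete {w : ℕ → ℕ} (D : DataStructure w) {N n : ℕ} (0<N : 0 < N) (2N≤n : N + N ≤ n) where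
  open DataStructure D using (k; r; cutProgram; sumProgram)
  open Caterpillar 0<N 2N≤n

  private
    RAM : Set
    RAM = State (w n) (k + r)

  -- The invariant is that every legal continuation is served; nothing is assumed about how the
  -- forest is represented in memory.
  Good : Forest n → RAM → Set
  Good F s = ∀ {m} (ops : Operations F m) → ∃[ t ] Serves D s ops t

  record Config : Set where
    field
      forest : Forest n
      state  : RAM
      good   : Good forest state
      shape  : Shape forest

  open Config

  -- In `serve` one `Op` becomes exactly one forest operation, whatever its bit, so the number of
  -- operations is the same for all choices of bits and queries.
  record Outcome (c : Config) : Set where
    field
      result      : Config
      cost        : ℕ
      trace       : List (Word (w n))
      trace≤cost  : length trace ≤ cost
      frame       : ∀ x → x ∉ trace → memory (state result) x ≡ memory (state c) x
      serve       : ∀ {m t} (ops : Operations (forest result) m) → Serves D (state result) ops t →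
                    Σ[ ops′ ∈ Operations (forest c) (suc m) ] Serves D (state c) ops′ (cost + t)

  open Outcome

  module Sum (c : Config) (v : Fin n) where

    answered : ∃[ t ] Σ[ s ∈ RAM ] Exec sumProgram (0 , withArgument D v (state c)) t s ×
                                   answer D {n} s ≡ subtreeSize (forest c) v
    answered with good c (subtree-sum v [])
    ... | _ , subtree-sum {s′ = s} {t = t} E a≡ [] = t , s , E , a≡

    time : ℕ
    time = proj₁ answered

    after : RAM
    after = proj₁ (proj₂ answered)

    exec : Exec sumProgram (0 , withArgument D v (state c)) time after
    exec = proj₁ (proj₂ (proj₂ answered))

    correct : answer D {n} after ≡ subtreeSize (forest c) v
    correct = proj₂ (proj₂ (proj₂ answered))

    after-good : Good (forest c) after
    after-good ops with good c (subtree-sum v ops)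
    ... | _ , subtree-sum E _ served with Exec-unique E exec
    ...   | refl = _ , served

    outcome : Outcome c
    outcome = record
      { result     = record { forest = forest c ; state = after ; good = after-good ; shape = shape c }
      ; cost       = time
      ; trace      = probes exec
      ; trace≤cost = length-probes exec
      ; frame      = λ x → probes-frame exec
      ; serve      = λ ops served → subtree-sum v ops , subtree-sum exec correct served
      }

  module Cut (c : Config) {p : ℕ} (p<N : p < N) (nonRoot : ¬ IsRoot (forest c) (pendant p)) where

    done : ∃[ t ] Σ[ s ∈ RAM ] Exec cutProgram (0 , withArgument D (pendant p) (state c)) t s
    done with good c (cut (pendant p) nonRoot [])
    ... | _ , cut {s′ = s} {t = t} E [] = t , s , E

    time : ℕ
    time = proj₁ done

    after : RAM
    after = proj₁ (proj₂ done)

    exec : Exec cutProgram (0 , withArgument D (pendant p) (state c)) time after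
    exec = proj₂ (proj₂ done)

    after-good : Good (cutEdge (forest c) (pendant p)) after
    after-good ops with good c (cut (pendant p) nonRoot ops)
    ... | _ , cut E served with Exec-unique E exec
    ...   | refl = _ , served

    outcome : Outcome c
    outcome = record
      { result     = record
          { forest = cutEdge (forest c) (pendant p)
          ; state  = after
          ; good   = after-good
          ; shape  = cut-shape (shape c) p<N
          }
      ; cost       = time
      ; trace      = probes exec
      ; trace≤cost = length-probes exec
      ; frame      = λ x → probes-frame exec
      ; serve      = λ ops served → cut (pendant p) nonRoot ops , cut exec served
      }

  isRoot? : ∀ (F : Forest n) v → Dec (IsRoot F v)
  isRoot? F v with parent F v
  ... | just _  = no λ ()
  ... | nothing = yes refl

  -- An update that is not to cut, or cannot, is replaced by a query.
  perform : ∀ c → Op → Outcome c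
  perform c (query q)        = Sum.outcome c (spine q)
  perform c (update p false) = Sum.outcome c (spine p)
  perform c (update p true) with p <? N | isRoot? (forest c) (pendant p)
  ... | yes p<N | no nonRoot = Cut.outcome c p<N nonRoot
  ... | yes _   | yes _      = Sum.outcome c (spine p)
  ... | no  _   | _          = Sum.outcome c (spine p)

  Attached : Config → ℕ → Set
  Attached c p = p < N × parent (forest c) (pendant p) ≡ just (spine p)

  attached-update : ∀ {c p p′} b → p ≢ p′ → Attached c p → Attached (result (perform c (update p′ b))) p
  attached-update false p≢p′ att = att
  attached-update {c} {p} {p′} true p≢p′ att@(p<N , p≡)
    with p′ <? N | isRoot? (forest c) (pendant p′)
  ... | no  _    | _     = att
  ... | yes _    | yes _ = att
  ... | yes p′<N | no  _ = p<N , trans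
    (cutEdge-off (forest c) (pendant p′) (p≢p′ ∘ pendant-injective p<N p′<N)) p≡

  size : Config → ℕ → ℕ
  size c q = subtreeSize (forest c) (spine q)

  size-update : ∀ {c p} b q → Attached c p → q < N →
                size (result (perform c (update p b))) q + bit (b ∧ (q ≤ᵇ p)) ≡ size c q
  size-update false q att q<N = +-identityʳ _
  size-update {c} {p} true q (p<N , p≡) q<N with p <? N | isRoot? (forest c) (pendant p)
  ... | yes _   | no _    = subtreeSize-cut-pendant (shape c) p<N p≡ q<N
  ... | yes _   | yes rt  = contradiction (trans (sym p≡) rt) λ ()
  ... | no p≮N  | _       = contradiction p<N p≮N

  simulated : ℕ → Vec (Word (w n)) (k + r) → (Word (w n) → Word (w n)) → ℕ → ℕ
  simulated fuel ρ mem q =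
    answer D {n} (execute fuel sumProgram (0 , withArgument D (spine q) ⟨ lookup ρ , mem ⟩))

  simulated-correct : ∀ c {q fuel mem} → cost (perform c (query q)) ≤ fuel →
    (∀ {x} → x ∈ trace (perform c (query q)) → mem x ≡ memory (state c) x) →
    simulated fuel (tabulate (registers (state c))) mem q ≡ size c q
  simulated-correct c {q} {fuel} t≤ M≡ = trans
    (cong toℕ (funToFin-cong λ i → sym
      (execute-correct (Sum.exec c (spine q)) fuel t≤ same (λ x∈ → sym (M≡ x∈)) (i ↑ˡ r))))
    (Sum.correct c (spine q))
    where
    same : ∀ j → registers (withArgument D (spine q) (state c)) j ≡
                 registers (withArgument D (spine q) ⟨ lookup (tabulate (registers (state c))) , memory (state c) ⟩) j
    same j with splitAt k j
    ... | inj₁ _ = refl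
    ... | inj₂ i = sym (lookup∘tabulate (registers (state c)) (k ↑ʳ i))

  machine : Machine N (2 ^ w n) (k + r)
  machine = record
    { address₀         = word (w n) 0
    ; Cfg              = Config
    ; registers        = λ c → tabulate (registers (state c))
    ; cell             = λ c → memory (state c)
    ; perform          = λ c o → result (perform c o)
    ; cost             = λ c o → cost (perform c o)
    ; trace            = λ c o → trace (perform c o)
    ; trace≤cost       = λ c o → trace≤cost (perform c o)
    ; frame            = λ c o → frame (perform c o)
    ; Available        = Attached
    ; available-query  = λ q att → att
    ; available-update = λ {c} → attached-update {c}
    ; response         = size
    ; response-query   = λ c q q′ → refl
    ; response-update  = λ {c} → size-update {c}
    ; simulate         = simulated
    ; simulate-correct = λ {c} t≤ _ M≡ → simulated-correct c t≤ M≡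
    }

  open LowerBound machine using (runCost)

  serve-all : ∀ {m} c os → length os ≡ m →
              Σ[ ops ∈ Operations (forest c) m ] Serves D (state c) ops (runCost c os)
  serve-all c []       refl = [] , []
  serve-all c (o ∷ os) refl = serve (perform c o) _ (proj₂ (serve-all (result (perform c o)) os refl))

-- Powers of two, logarithms and rounding.

n<2^n : ∀ n → n < 2 ^ n
n<2^n zero    = z<s
n<2^n (suc n) = begin-strict
  suc n          <⟨ s≤s (n<2^n n) ⟩
  1 + 2 ^ n      ≤⟨ +-monoˡ-≤ (2 ^ n) (m^n>0 2 n) ⟩
  2 ^ n + 2 ^ n  ≡⟨ cong (2 ^ n +_) (+-identityʳ (2 ^ n)) ⟨
  2 ^ suc n      ∎
  where open ≤-Reasoning

4*n≤2^n : ∀ {n} → 4 ≤ n → 4 * n ≤ 2 ^ n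
4*n≤2^n {n} 4≤n = subst (λ m → 4 * m ≤ 2 ^ m) (m+[n∸m]≡n 4≤n) (go (n ∸ 4))
  where
  go : ∀ i → 4 * (4 + i) ≤ 2 ^ (4 + i)
  go zero    = ≤-refl
  go (suc i) = begin
    4 * (4 + suc i)          ≡⟨ lemma i ⟩
    4 * (4 + i) + 4          ≤⟨ +-monoʳ-≤ (4 * (4 + i)) (m≤m*n 4 (4 + i)) ⟩
    4 * (4 + i) + 4 * (4 + i) ≡⟨ cong (4 * (4 + i) +_) (+-identityʳ _) ⟨
    2 * (4 * (4 + i))        ≤⟨ *-monoʳ-≤ 2 (go i) ⟩
    2 ^ (4 + suc i)          ∎
    where
    open ≤-Reasoning
    lemma : ∀ i → 4 * (4 + suc i) ≡ 4 * (4 + i) + 4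
    lemma = solve-∀

n<2^[1+⌊log₂n⌋] : ∀ n → n < 2 ^ suc ⌊log₂ n ⌋
n<2^[1+⌊log₂n⌋] n = ≰⇒> λ 2^≤n →
  1+n≰n (subst (_≤ ⌊log₂ n ⌋) (⌊log₂[2^n]⌋≡n (suc ⌊log₂ n ⌋)) (⌊log₂⌋-mono-≤ 2^≤n))

2^⌊log₂n⌋≤n : ∀ n → 0 < n → 2 ^ ⌊log₂ n ⌋ ≤ n
2^⌊log₂n⌋≤n = <-rec (λ n → 0 < n → 2 ^ ⌊log₂ n ⌋ ≤ n) go
  where
  go : ∀ n → (∀ {m} → m < n → 0 < m → 2 ^ ⌊log₂ m ⌋ ≤ m) → 0 < n → 2 ^ ⌊log₂ n ⌋ ≤ n
  go (suc zero)       rec _ = ≤-refl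
  go n@(suc (suc n′)) rec _ = begin
    2 ^ ⌊log₂ n ⌋              ≤⟨ ^-monoʳ-≤ 2 (≤-trans (m≤n+m∸n ⌊log₂ n ⌋ 1)
                                    (≤-reflexive (cong suc (sym (⌊log₂⌊n/2⌋⌋≡⌊log₂n⌋∸1 n))))) ⟩
    2 * 2 ^ ⌊log₂ ⌊ n /2⌋ ⌋    ≤⟨ *-monoʳ-≤ 2 (rec (⌊n/2⌋<n (suc n′)) z<s) ⟩
    2 * ⌊ n /2⌋                ≡⟨ cong (⌊ n /2⌋ +_) (+-identityʳ ⌊ n /2⌋) ⟩
    ⌊ n /2⌋ + ⌊ n /2⌋          ≤⟨ +-monoʳ-≤ ⌊ n /2⌋ (⌊n/2⌋≤⌈n/2⌉ n) ⟩
    ⌊ n /2⌋ + ⌈ n /2⌉          ≡⟨ ⌊n/2⌋+⌈n/2⌉≡n n ⟩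
    n                          ∎
    where open ≤-Reasoning

-- A summary has `w * (r + 2 * M * t)` bits. Since `w ≤ M`, the main term is at most
-- `2 * M * M * t`: hence `v` twice and 1 in the exponent, while `r` is there because `r < 2 ^ r`.
few-summaries : ∀ {w r v} → w ≤ 2 ^ v → ∀ k →
                2 * length (summaries (2 ^ w) r (2 ^ v * 2 ^ k)) ≤ 8 ^ (2 ^ (v + (v + (1 + r))) * 2 ^ k)
few-summaries {w} {r} {v} w≤ k = begin
  2 * length (summaries (2 ^ w) r (M * t))  ≡⟨ cong (2 *_) (length-summaries (2 ^ w) r (M * t)) ⟩
  2 * (2 ^ w) ^ (r + 2 * (M * t))           ≡⟨ cong (2 *_) (^-*-assoc 2 w (r + 2 * (M * t))) ⟩
  2 ^ (1 + w * (r + 2 * (M * t)))           ≤⟨ ^-monoʳ-≤ 2 exponents ⟩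
  2 ^ (3 * (G * t))                         ≡⟨ ^-*-assoc 2 3 (G * t) ⟨
  8 ^ (G * t)                               ∎
  where
  open ≤-Reasoning
  M = 2 ^ v
  t = 2 ^ k
  ρ = 2 ^ r
  G = 2 ^ (v + (v + (1 + r)))
  G≡ : G ≡ M * (M * (2 * ρ))
  G≡ = trans (^-distribˡ-+-* 2 v _) (cong (M *_) (^-distribˡ-+-* 2 v (1 + r)))
  1≤t : 1 ≤ t
  1≤t = m^n>0 2 k
  1≤M : 1 ≤ M
  1≤M = m^n>0 2 v
  1≤ρ : 1 ≤ ρ
  1≤ρ = m^n>0 2 r
  wr≤ : w * r ≤ G
  wr≤ = begin
    w * r              ≤⟨ *-mono-≤ w≤ (<⇒≤ (n<2^n r)) ⟩
    M * ρ              ≤⟨ *-monoʳ-≤ M (m≤m+n ρ _) ⟩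
    M * (2 * ρ)        ≤⟨ *-monoʳ-≤ M (≤-trans (≤-reflexive (sym (*-identityˡ _))) (*-monoˡ-≤ (2 * ρ) 1≤M)) ⟩
    M * (M * (2 * ρ))  ≡⟨ G≡ ⟨
    G                  ∎
  w2M≤ : w * (2 * M) ≤ G
  w2M≤ = begin
    w * (2 * M)        ≤⟨ *-monoˡ-≤ (2 * M) w≤ ⟩
    M * (2 * M)        ≡⟨ cong (M *_) (trans (*-comm 2 M) (cong (M *_) (sym (*-identityʳ 2)))) ⟩
    M * (M * (2 * 1))  ≤⟨ *-monoʳ-≤ M (*-monoʳ-≤ M (*-monoʳ-≤ 2 1≤ρ)) ⟩
    M * (M * (2 * ρ))  ≡⟨ G≡ ⟨
    G                  ∎
  exponents : 1 + w * (r + 2 * (M * t)) ≤ 3 * (G * t)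
  exponents = begin
    1 + w * (r + 2 * (M * t))                ≡⟨ lemma₁ w r M t ⟩
    1 * 1 + w * r * 1 + w * (2 * M) * t      ≤⟨ +-mono-≤ (+-mono-≤ (*-mono-≤ (m^n>0 2 (v + (v + (1 + r)))) 1≤t) (*-mono-≤ wr≤ 1≤t))
                                                         (*-monoˡ-≤ t w2M≤) ⟩
    G * t + G * t + G * t                    ≡⟨ lemma₂ (G * t) ⟩
    3 * (G * t)                              ∎
    where
    lemma₁ : ∀ w r M t → 1 + w * (r + 2 * (M * t)) ≡ 1 * 1 + w * r * 1 + w * (2 * M) * t
    lemma₁ = solve-∀
    lemma₂ : ∀ z → z + z + z ≡ 3 * z
    lemma₂ = solve-∀

m≤2*[m/n]*n : ∀ m n .{{_ : NonZero n}} → n ≤ m → m ≤ 2 * (m / n * n)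
m≤2*[m/n]*n m n n≤m = begin
  m                      ≡⟨ m≡m%n+[m/n]*n m n ⟩
  m % n + m / n * n      ≤⟨ +-monoˡ-≤ (m / n * n) (<⇒≤ (m%n<n m n)) ⟩
  n + m / n * n          ≡⟨ cong (_+ m / n * n) (*-identityˡ n) ⟨
  1 * n + m / n * n      ≤⟨ +-monoˡ-≤ (m / n * n) (*-monoˡ-≤ n (m≥n⇒m/n>0 n≤m)) ⟩
  m / n * n + m / n * n  ≡⟨ cong (m / n * n +_) (+-identityʳ (m / n * n)) ⟨
  2 * (m / n * n)        ∎
  where open ≤-Reasoning

-- Choice of parameters.

module Final {w : ℕ → ℕ} (D : DataStructure w) (c₁ : ℕ) where
  open DataStructure D using (k; r; initial)

  -- The part of `g` that does not grow with `n`; 7 collects 4 from `g`, 1 from `g₂` and 1 from each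
  -- of its two copies of `v`.
  C : ℕ
  C = c₁ + (c₁ + (k + r + 7))

  -- 16 is lost in `n ≤ 4 * N`, `L ≤ 2 * b` and `b ≤ 2 * (j * g)`; 68 comes from `expensive`, and
  -- `2 + C` bounds `g` by a multiple of `x`.
  factor : ℕ
  factor = 16 * (68 * (2 + C))

  module _ {n : ℕ} (w≤ : w n ≤ c₁ * ⌊log₂ n ⌋) (large : suc C ≤ ⌊log₂ ⌊log₂ n ⌋ ⌋)
           (good : (F : Forest n) → ∀ {m} (ops : Operations F m) → ∃[ t ] Serves D (initial F) ops t) where

    -- `v` is chosen so that `2 ^ v` bounds both the word size and the number `j` of levels; `b` is
    -- one less than `L` so that spine and leaves fit into `n` vertices.
    L x v M g₂ g b N j d : ℕ
    L  = ⌊log₂ n ⌋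
    x  = ⌊log₂ L ⌋
    v  = suc x + c₁
    M  = 2 ^ v
    g₂ = v + (v + (1 + (k + r)))
    g  = 4 + g₂
    b  = L ∸ 1
    N  = 2 ^ b
    j  = b / g
    d  = b % g

    g≡2x+C : g ≡ 2 * x + C
    g≡2x+C = lemma x c₁ (k + r)
      where
      lemma : ∀ x c k → 4 + (suc x + c + (suc x + c + (1 + k))) ≡ 2 * x + (c + (c + (k + 7)))
      lemma = solve-∀

    7≤C : 7 ≤ C
    7≤C = ≤-trans (m≤n+m 7 (k + r)) (≤-trans (m≤n+m _ c₁) (m≤n+m _ c₁))

    0<L : 0 < L
    0<L = n≢0⇒n>0 λ L≡0 → contradiction (subst (λ l → suc C ≤ ⌊log₂ l ⌋) L≡0 large) λ ()

    -- Makes room for at least one level, so that rounding `b / g` down loses at most a factor 2.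
    g<L : suc g ≤ L
    g<L = begin
      suc g            ≡⟨ cong suc g≡2x+C ⟩
      suc (2 * x + C)  ≡⟨ +-suc (2 * x) C ⟨
      2 * x + suc C    ≤⟨ +-monoʳ-≤ (2 * x) (≤-trans large (m≤m+n x _)) ⟩
      2 * x + 2 * x    ≡⟨ lemma x ⟩
      4 * x            ≤⟨ 4*n≤2^n (≤-trans (≤-trans (m≤m+n 4 3) 7≤C) (≤-trans (n≤1+n C) large)) ⟩
      2 ^ x            ≤⟨ 2^⌊log₂n⌋≤n L 0<L ⟩
      L                ∎
      where
      open ≤-Reasoning
      lemma : ∀ x → 2 * x + 2 * x ≡ 4 * x
      lemma = solve-∀

    L≡1+b : L ≡ suc b
    L≡1+b = sym (m+[n∸m]≡n 0<L)

    g≤b : g ≤ b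
    g≤b = ∸-monoˡ-≤ 1 g<L

    0<n : 0 < n
    0<n = n≢0⇒n>0 λ { refl → contradiction 0<L λ () }

    2N≤n : N + N ≤ n
    2N≤n = begin
      N + N      ≡⟨ cong (N +_) (+-identityʳ N) ⟨
      2 ^ suc b  ≡⟨ cong (2 ^_) L≡1+b ⟨
      2 ^ L      ≤⟨ 2^⌊log₂n⌋≤n n 0<n ⟩
      n          ∎
      where open ≤-Reasoning

    n≤4N : n ≤ 4 * N
    n≤4N = begin
      n          ≤⟨ <⇒≤ (n<2^[1+⌊log₂n⌋] n) ⟩
      2 * 2 ^ L  ≡⟨ cong (λ l → 2 * 2 ^ l) L≡1+b ⟩
      2 * (2 * N) ≡⟨ *-assoc 2 2 N ⟨
      4 * N      ∎
      where open ≤-Reasoning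

    L≤2^1+x : L ≤ 2 ^ suc x
    L≤2^1+x = <⇒≤ (n<2^[1+⌊log₂n⌋] L)

    M≡ : M ≡ 2 ^ suc x * 2 ^ c₁
    M≡ = ^-distribˡ-+-* 2 (suc x) c₁

    w≤M : w n ≤ M
    w≤M = begin
      w n                 ≤⟨ w≤ ⟩
      c₁ * L              ≤⟨ *-mono-≤ (<⇒≤ (n<2^n c₁)) L≤2^1+x ⟩
      2 ^ c₁ * 2 ^ suc x  ≡⟨ trans (*-comm (2 ^ c₁) (2 ^ suc x)) (sym M≡) ⟩
      M                   ∎
      where open ≤-Reasoning

    j≤M : j ≤ M
    j≤M = begin
      j                   ≤⟨ m/n≤m b g ⟩
      b                   ≤⟨ m∸n≤m L 1 ⟩
      L                   ≤⟨ L≤2^1+x ⟩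
      2 ^ suc x           ≡⟨ *-identityʳ (2 ^ suc x) ⟨
      2 ^ suc x * 1       ≤⟨ *-monoʳ-≤ (2 ^ suc x) (m^n>0 2 c₁) ⟩
      2 ^ suc x * 2 ^ c₁  ≡⟨ M≡ ⟨
      M                   ∎
      where open ≤-Reasoning

    0<N : 0 < N
    0<N = m^n>0 2 b

    open Caterpillar 0<N 2N≤n using (caterpillar; caterpillar-shape; caterpillar-pendant)
    open Concrete D 0<N 2N≤n using (Config; machine; serve-all)
    open LowerBound machine using (ops; length-ops; run; runCost; runCost-++)
    open Levels machine M g₂ (few-summaries {w n} {k + r} {v} w≤M) using (expensive)

    origin : Config
    origin = record
      { forest = caterpillar
      ; state  = initial caterpillar
      ; good   = good caterpillar
      ; shape  = caterpillar-shape
      }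

    N≡ : N ≡ 2 ^ (d + j * g)
    N≡ = cong (2 ^_) (m≡m%n+[m/n]*n b g)

    costly : ∃[ ω ] j * N ≤ 68 * runCost origin (ops {d + j * g} 0 1 ω)
    costly = expensive j d (m^n>0 2 v) j≤M N≡ λ h h< →
      let h*1<N = subst₂ _<_ (sym (*-identityʳ h)) (sym N≡) h< in h*1<N , caterpillar-pendant h*1<N

    rounds padding os : List Op
    rounds  = ops 0 1 (proj₁ costly)
    -- The rounds take `2 * N` operations; queries, whose cost can only help, fill up to exactly
    -- `n`.
    padding = replicate (n ∸ (N + N)) (query 0)
    os      = rounds ++ padding

    length-os : length os ≡ n
    length-os = begin
      length os                          ≡⟨ length-++ rounds ⟩
      length rounds + length padding     ≡⟨ cong₂ _+_ (length-ops 0 1 (proj₁ costly)) (length-replicate (n ∸ (N + N))) ⟩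
      2 * 2 ^ (d + j * g) + (n ∸ (N + N)) ≡⟨ cong (λ l → 2 * l + (n ∸ (N + N))) N≡ ⟨
      2 * N + (n ∸ (N + N))              ≡⟨ cong (λ l → N + l + (n ∸ (N + N))) (+-identityʳ N) ⟩
      N + N + (n ∸ (N + N))              ≡⟨ m+[n∸m]≡n 2N≤n ⟩
      n                                  ∎
      where open ≡-Reasoning

    t : ℕ
    t = runCost origin os

    jN≤68t : j * N ≤ 68 * t
    jN≤68t = begin
      j * N                        ≤⟨ proj₂ costly ⟩
      68 * runCost origin rounds    ≤⟨ *-monoʳ-≤ 68 (m≤m+n (runCost origin rounds) (runCost (run origin rounds) padding)) ⟩
      68 * (runCost origin rounds + runCost (run origin rounds) padding)
                                   ≡⟨ cong (68 *_) (runCost-++ origin rounds padding) ⟨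
      68 * t                       ∎
      where open ≤-Reasoning

    time-bound : n * L ≤ factor * (t * x)
    time-bound = begin
      n * L
        ≤⟨ *-mono-≤ n≤4N L≤2b ⟩
      4 * N * (2 * b)
        ≤⟨ *-monoʳ-≤ (4 * N) (*-monoʳ-≤ 2 (m≤2*[m/n]*n b g g≤b)) ⟩
      4 * N * (2 * (2 * (j * g)))
        ≡⟨ lemma₁ N j g ⟩
      16 * (g * (j * N))
        ≤⟨ *-monoʳ-≤ 16 (*-mono-≤ g≤ jN≤68t) ⟩
      16 * ((2 + C) * x * (68 * t))
        ≡⟨ lemma₂ 68 (2 + C) x t ⟩
      factor * (t * x) ∎
      where
      open ≤-Reasoning
      lemma₁ : ∀ N j g → 4 * N * (2 * (2 * (j * g))) ≡ 16 * (g * (j * N))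
      lemma₁ = solve-∀
      lemma₂ : ∀ K c x t → 16 * (c * x * (K * t)) ≡ 16 * (K * c) * (t * x)
      lemma₂ = solve-∀
      L≤2b : L ≤ 2 * b
      L≤2b = begin
        L            ≡⟨ L≡1+b ⟩
        1 + b        ≤⟨ +-monoˡ-≤ b (≤-trans (s≤s z≤n) g≤b) ⟩
        b + b        ≡⟨ cong (b +_) (+-identityʳ b) ⟨
        2 * b        ∎
      g≤ : g ≤ (2 + C) * x
      g≤ = begin
        g                ≡⟨ g≡2x+C ⟩
        2 * x + C        ≡⟨ cong (2 * x +_) (*-identityʳ C) ⟨
        2 * x + C * 1    ≤⟨ +-monoʳ-≤ (2 * x) (*-monoʳ-≤ C (≤-trans (s≤s z≤n) large)) ⟩
        2 * x + C * x    ≡⟨ *-distribʳ-+ x 2 C ⟨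
        (2 + C) * x      ∎

    witness : Σ[ F ∈ Forest n ] Σ[ ops ∈ Operations F n ] ∃[ t ]
              Serves D (initial F) ops t × n * ⌊log₂ n ⌋ ≤ factor * (t * ⌊log₂ ⌊log₂ n ⌋ ⌋)
    witness = caterpillar , proj₁ served , t , proj₂ served , time-bound
      where served = serve-all origin os length-os

theorem7 : (w : ℕ → ℕ) → w =Θ (λ n → ⌊log₂ n ⌋) →
    (D : DataStructure w) → MaintainsForests D →
    ∃[ c ] ∃[ n₀ ] (∀ n → n ≥ n₀ →
    Σ[ F ∈ Forest n ] Σ[ ops ∈ Operations F n ] ∃[ t ]
    Serves D (DataStructure.initial D F) ops t ×
    n * ⌊log₂ n ⌋ ≤ c * (t * ⌊log₂ ⌊log₂ n ⌋ ⌋))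
theorem7 w (c₁ , nᵂ , w≈log) D (nᴰ , maintains) =
  -- The last summand makes log log n at least `suc C`, as `g<L` requires.
  factor , nᵂ + (nᴰ + 2 ^ (2 ^ suc C)) , λ n n≥ →
    let n≥nᵂ  = ≤-trans (m≤m+n nᵂ _) n≥
        n≥    = ≤-trans (m≤n+m _ nᵂ) n≥
        n≥nᴰ  = ≤-trans (m≤m+n nᴰ _) n≥
        n≥2^2 = ≤-trans (m≤n+m _ nᴰ) n≥
    in witness (proj₁ (w≈log n n≥nᵂ)) (large n≥2^2) (maintains n n≥nᴰ)
  where
  open Final D c₁
  large : ∀ {n} → 2 ^ (2 ^ suc C) ≤ n → suc C ≤ ⌊log₂ ⌊log₂ n ⌋ ⌋
  large {n} n≥ = begin
    suc C                                  ≡⟨ ⌊log₂[2^n]⌋≡n (suc C) ⟨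
    ⌊log₂ 2 ^ suc C ⌋                      ≡⟨ cong ⌊log₂_⌋ (⌊log₂[2^n]⌋≡n (2 ^ suc C)) ⟨
    ⌊log₂ ⌊log₂ 2 ^ (2 ^ suc C) ⌋ ⌋        ≤⟨ ⌊log₂⌋-mono-≤ (⌊log₂⌋-mono-≤ n≥) ⟩
    ⌊log₂ ⌊log₂ n ⌋ ⌋                      ∎
    where open ≤-Reasoning
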